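{- For every positive integer $n$ there is an integer $d(n)$ such that if $d>d(n)$ and $H$ is a balanced subgroup of $G=(\mathbb{Z}/d\mathbb{Z})^\times$ of order $n$, then either $-1\in H$, or $4\mid d$ and $\frac12 d+1\in H$.
   Context: For an integer $d>2$, let $A_d\subset(\mathbb{Z}/d\mathbb{Z})^\times$ be the set of residues having a representative in $(0,d/2)$ and $B_d=(\mathbb{Z}/d\mathbb{Z})^\times\setminus A_d$. A subgroup $H$ of $(\mathbb{Z}/d\mathbb{Z})^\times$ is called balanced if for every $u\in(\mathbb{Z}/d\mathbb{Z})^\times$ we have $|uH\cap A_d|=|uH\cap B_d|$. -}

module Defs where

open import Data.Nat using (ℕ; _+_; _*_; _<_; _<?_; NonZero)
open import Data.Nat.DivMod using (_%_)
open import Data.Nat.Coprimality using (Coprime)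
open import Data.List using (List; map; filter; length)
open import Data.List.Membership.Propositional using (_∈_)
open import Data.List.Relation.Unary.Unique.Propositional using (Unique)
open import Data.Product using (_×_; ∃-syntax)
open import Relation.Binary.PropositionalEquality using (_≡_)
open import Relation.Nullary using (¬?)

-- Residues mod d are represented by their canonical representatives r ∈ {0,…,d-1}.
-- r represents a unit of ℤ/dℤ iff r < d and gcd(r,d) = 1.
IsUnit : ℕ → ℕ → Set
IsUnit d r = (r < d) × Coprime r d

mulMod : (d : ℕ) → .{{_ : NonZero d}} → ℕ → ℕ → ℕ
mulMod d a b = (a * b) % d

record IsSubgroup (d : ℕ) .{{_ : NonZero d}} (H : List ℕ) : Set where
  field
    unique   : Unique H
    units    : ∀ {h} → h ∈ H → IsUnit d h
    one∈     : (1 % d) ∈ H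
    mul∈     : ∀ {a b} → a ∈ H → b ∈ H → mulMod d a b ∈ H
    inv∈     : ∀ {a} → a ∈ H → ∃[ b ] (b ∈ H × mulMod d a b ≡ 1 % d)

coset : (d : ℕ) → .{{_ : NonZero d}} → ℕ → List ℕ → List ℕ
coset d u H = map (mulMod d u) H

-- |L ∩ A_d| for a list L of units: residues with a representative in (0, d/2), i.e. 2r < d
countA : ℕ → List ℕ → ℕ
countA d L = length (filter (λ r → 2 * r <? d) L)

countB : ℕ → List ℕ → ℕ
countB d L = length (filter (λ r → ¬? (2 * r <? d)) L)

Balanced : (d : ℕ) → .{{_ : NonZero d}} → List ℕ → Set
Balanced d H = ∀ u → IsUnit d u → countA d (coset d u H) ≡ countB d (coset d u H)

{-# OPTIONS --safe #-}
module Submission where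

-- Let φ be the indicator of the lower half of ℤ/d.  Balancedness says that Σ_{h ∈ H} φ(u h) = n/2 for
-- every unit u, so this sum agrees at any two units u and v.  Compare u = 1 + k P just below d/2 with
-- v = u + K P just above it, for K consecutive k, where P is the product of the primes up to y ≈ log d.
-- The large primes dividing d are so few that almost all of these u and v are units.  The term h = 1
-- always drops from 1 to 0, and the other terms have to compensate for it.  By Dirichlet, q P h ≡ ±r with
-- 1 ≤ q ≤ C and r ≤ d/C.  If r is large, then u h and v h run through progressions that spend about half
-- of their time in each half, so h contributes little.  If r is small, then raising to the order of h gives
-- r = q P, so K P h ≡ ± K P; then φ(u h) < φ(v h) forces h = −1, or h = 1 + d/2 with 4 ∣ d.

open import Defs
open import Data.Nat
open import Data.Nat.Properties
open import Data.Nat.DivMod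
open import Data.Nat.Divisibility
open import Data.Nat.Combinatorics using (k![n∸k]!∣n!)
open import Data.Nat.Coprimality using (Coprime; coprime?; coprime-divisor)
import Data.Nat.Coprimality as Coprimality
open import Data.Nat.ListAction using (sum; product)
open import Data.Nat.Primality
open import Data.Nat.Primality.Factorisation using (factorise; PrimeFactorisation; factorisationHasAllPrimeFactors)
open import Data.Nat.Tactic.RingSolver using (solve-∀)
open import Data.Bool using (if_then_else_)
open import Data.Empty using (⊥; ⊥-elim)
open import Data.Fin using (Fin; toℕ; fromℕ<)
open import Data.Fin.Properties using (pigeonhole; toℕ<n; fromℕ<-injective)
open import Data.List using (List; []; _∷_; length; lookup; map; filter)
open import Data.List.Properties using (map-∘; length-map; filter-accept; filter-reject)
open import Data.List.Membership.DecPropositional _≟_ using (_∈?_)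
open import Data.List.Membership.Propositional using (_∈_; find; lose)
open import Data.List.Membership.Propositional.Properties using (∈-filter⁺; ∈-filter⁻)
open import Data.List.Relation.Unary.All using (All; []; _∷_)
import Data.List.Relation.Unary.All as All
open import Data.List.Relation.Unary.Any using (here; there; any?; index)
open import Data.List.Relation.Unary.Any.Properties using (lookup-index)
open import Data.Product using (∃-syntax; ∃₂; _×_; _,_; proj₁; proj₂)
open import Data.Sum using (_⊎_; inj₁; inj₂; [_,_]′)
open import Function using (_∘_)
open import Relation.Binary.PropositionalEquality
open import Relation.Nullary
open import Relation.Nullary.Decidable using (dec-true; dec-false)
open import Relation.Unary using (Decidable)

-- Two demands on `y` compete. About log d / log y primes above `y` can spoil a `u` or `v`, each at
-- most one member in `y`, so `y` must exceed a multiple of log d / log y. But `P`, which may be as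
-- large as `4 ^ y`, must stay below a small power of d, because relations of size about `P * P` are
-- raised to the power 2n and compared with d. Bracketing d between `4 ^ (A * y)` and
-- `4 ^ (2 * A * y)` with `y = 2 ^ J` meets both. The threshold `R` between small and large r is
-- forced as well. The torsion argument needs `C * P * (K * P)` below d/2, so `K` is about d / (2 C
-- P²). Then `K` steps of size r go round often enough only if r is at least about 4 C³ P².

-- A certificate form of linear arithmetic: the equation is left to the ring solver.
linear : ∀ {l r x y} c → l ≤ r → x + r + c ≡ y + l → x ≤ y
linear {l} {r} {x} {y} c l≤r eq = +-cancelʳ-≤ r x y (begin
  x + r      ≤⟨ m≤m+n (x + r) c ⟩
  x + r + c  ≡⟨ eq ⟩
  y + l      ≤⟨ +-monoʳ-≤ y l≤r ⟩
  y + r      ∎)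
  where open ≤-Reasoning

-- Finite sums over initial segments of the naturals

∑ : ℕ → (ℕ → ℕ) → ℕ
∑ zero    f = 0
∑ (suc n) f = ∑ n f + f n

∑-cong : ∀ n {f g} → (∀ i → i < n → f i ≡ g i) → ∑ n f ≡ ∑ n g
∑-cong zero    eq = refl
∑-cong (suc n) eq = cong₂ _+_ (∑-cong n (λ i i<n → eq i (m<n⇒m<1+n i<n))) (eq n ≤-refl)

∑-mono : ∀ n {f g} → (∀ i → i < n → f i ≤ g i) → ∑ n f ≤ ∑ n g
∑-mono zero    le = z≤n
∑-mono (suc n) le = +-mono-≤ (∑-mono n (λ i i<n → le i (m<n⇒m<1+n i<n))) (le n ≤-refl)

∑-+ : ∀ n f g → ∑ n (λ i → f i + g i) ≡ ∑ n f + ∑ n g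
∑-+ zero    f g = refl
∑-+ (suc n) f g = trans (cong (_+ (f n + g n)) (∑-+ n f g)) (lemma (∑ n f) (∑ n g) (f n) (g n))
  where
  lemma : ∀ a b c e → a + b + (c + e) ≡ a + c + (b + e)
  lemma = solve-∀

∑-* : ∀ n c f → ∑ n (λ i → c * f i) ≡ c * ∑ n f
∑-* zero    c f = sym (*-zeroʳ c)
∑-* (suc n) c f = trans (cong (_+ c * f n) (∑-* n c f)) (sym (*-distribˡ-+ c (∑ n f) (f n)))

∑-const : ∀ n c → ∑ n (λ _ → c) ≡ n * c
∑-const zero    c = refl
∑-const (suc n) c = trans (cong (_+ c) (∑-const n c)) (+-comm (n * c) c)

∑-split : ∀ m n f → ∑ (m + n) f ≡ ∑ m f + ∑ n (λ i → f (m + i))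
∑-split m zero    f = trans (cong (λ k → ∑ k f) (+-identityʳ m)) (sym (+-identityʳ _))
∑-split m (suc n) f = begin
  ∑ (m + suc n) f                                  ≡⟨ cong (λ k → ∑ k f) (+-suc m n) ⟩
  ∑ (m + n) f + f (m + n)                          ≡⟨ cong (_+ f (m + n)) (∑-split m n f) ⟩
  ∑ m f + ∑ n (λ i → f (m + i)) + f (m + n)        ≡⟨ +-assoc (∑ m f) _ _ ⟩
  ∑ m f + (∑ n (λ i → f (m + i)) + f (m + n))      ∎
  where open ≡-Reasoning

∑-swap : ∀ m n (f : ℕ → ℕ → ℕ) → ∑ m (λ i → ∑ n (f i)) ≡ ∑ n (λ j → ∑ m (λ i → f i j))
∑-swap zero    n f = sym (trans (∑-const n 0) (*-zeroʳ n))
∑-swap (suc m) n f = trans (cong (_+ ∑ n (f m)) (∑-swap m n f)) (sym (∑-+ n _ (f m)))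

∑-blocks : ∀ m q f → ∑ (m * q) f ≡ ∑ m (λ k → ∑ q (λ i → f (k * q + i)))
∑-blocks zero    q f = refl
∑-blocks (suc m) q f = begin
  ∑ (q + m * q) f                                                       ≡⟨ cong (λ k → ∑ k f) (+-comm q (m * q)) ⟩
  ∑ (m * q + q) f                                                       ≡⟨ ∑-split (m * q) q f ⟩
  ∑ (m * q) f + ∑ q (λ i → f (m * q + i))                               ≡⟨ cong (_+ ∑ q (λ i → f (m * q + i))) (∑-blocks m q f) ⟩
  ∑ m (λ k → ∑ q (λ i → f (k * q + i))) + ∑ q (λ i → f (m * q + i))     ∎
  where open ≡-Reasoning

∑-reverse : ∀ n f → ∑ n (λ i → f (n ∸ suc i)) ≡ ∑ n f
∑-reverse zero    f = refl
∑-reverse (suc n) f = begin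
  ∑ n (λ i → f (n ∸ i)) + f (n ∸ n)                ≡⟨ cong₂ _+_ (∑-cong n (λ i i<n → cong f (sym (suc-shift i i<n)))) (cong f (n∸n≡0 n)) ⟩
  ∑ n (λ i → f (suc (n ∸ suc i))) + f 0            ≡⟨ cong (_+ f 0) (∑-reverse n (f ∘ suc)) ⟩
  ∑ n (f ∘ suc) + f 0                              ≡⟨ +-comm _ (f 0) ⟩
  f 0 + ∑ n (f ∘ suc)                              ≡⟨ ∑-split 1 n f ⟨
  ∑ (suc n) f                                      ∎
  where
  open ≡-Reasoning
  suc-shift : ∀ i → i < n → suc (n ∸ suc i) ≡ n ∸ i
  suc-shift i i<n = sym (+-∸-assoc 1 i<n)

⟦_⟧ : ∀ {a} {A : Set a} → Dec A → ℕ
⟦ p ⟧ = if does p then 1 else 0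

⟦⟧-true : ∀ {a} {A : Set a} (p : Dec A) → A → ⟦ p ⟧ ≡ 1
⟦⟧-true p a rewrite dec-true p a = refl

⟦⟧-false : ∀ {a} {A : Set a} (p : Dec A) → ¬ A → ⟦ p ⟧ ≡ 0
⟦⟧-false p ¬a rewrite dec-false p ¬a = refl

⟦⟧≤1 : ∀ {a} {A : Set a} (p : Dec A) → ⟦ p ⟧ ≤ 1
⟦⟧≤1 (yes _) = ≤-refl
⟦⟧≤1 (no _)  = z≤n

-- Progressions in the lower half

module Low (d : ℕ) .{{_ : NonZero d}} where

  low : ℕ → ℕ
  low x = ⟦ 2 * (x % d) <? d ⟧

  low≤1 : ∀ x → low x ≤ 1
  low≤1 x = ⟦⟧≤1 (2 * (x % d) <? d)

  low-cong : ∀ {x y} → x % d ≡ y % d → low x ≡ low y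
  low-cong eq = cong (λ z → ⟦ 2 * z <? d ⟧) eq

  low-+d : ∀ x → low (x + d) ≡ low x
  low-+d x = low-cong ([m+n]%n≡m%n x d)

  -- The index of the half-period that contains `x`. Unlike the residue it is monotone, so its
  -- increments count crossings; its parity recovers `low`.
  halves : ℕ → ℕ
  halves x = 2 * x / d

  halves-lower : ∀ x → halves x * d ≤ 2 * x
  halves-lower x = m/n*n≤m (2 * x) d

  halves-upper : ∀ x → 2 * x ≤ d + halves x * d
  halves-upper x = begin
    2 * x                           ≡⟨ m≡m%n+[m/n]*n (2 * x) d ⟩
    (2 * x) % d + halves x * d      ≤⟨ +-monoˡ-≤ (halves x * d) (m%n≤n (2 * x) d) ⟩
    d + halves x * d                ∎
    where open ≤-Reasoning

  halves-mono : ∀ {x y} → x ≤ y → halves x ≤ halves y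
  halves-mono x≤y = /-monoˡ-≤ d (*-monoʳ-≤ 2 x≤y)

  halves-decompose : ∀ x → halves x ≡ 2 * (x % d) / d + (x / d) * 2
  halves-decompose x = begin
    2 * x / d                                     ≡⟨ /-congˡ (cong (2 *_) (m≡m%n+[m/n]*n x d)) ⟩
    2 * (x % d + (x / d) * d) / d                 ≡⟨ /-congˡ (lemma (x % d) (x / d) d) ⟩
    (2 * (x % d) + (x / d) * 2 * d) / d           ≡⟨ +-distrib-/-∣ʳ (2 * (x % d)) (divides (x / d * 2) refl) ⟩
    2 * (x % d) / d + (x / d) * 2 * d / d         ≡⟨ cong (2 * (x % d) / d +_) (m*n/n≡m (x / d * 2) d) ⟩
    2 * (x % d) / d + (x / d) * 2                 ∎
    where
    open ≡-Reasoning
    lemma : ∀ a b c → 2 * (a + b * c) ≡ 2 * a + b * 2 * c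
    lemma = solve-∀

  low-parity : ∀ x → low x ≡ 1 ∸ halves x % 2
  low-parity x with 2 * (x % d) <? d
  ... | yes p = trans (⟦⟧-true (2 * (x % d) <? d) p) (sym (cong (1 ∸_) (begin
    halves x % 2                              ≡⟨ cong (_% 2) (halves-decompose x) ⟩
    (2 * (x % d) / d + (x / d) * 2) % 2       ≡⟨ [m+kn]%n≡m%n (2 * (x % d) / d) (x / d) 2 ⟩
    2 * (x % d) / d % 2                       ≡⟨ cong (_% 2) (m<n⇒m/n≡0 p) ⟩
    0                                         ∎)))
    where open ≡-Reasoning
  ... | no ¬p = trans (⟦⟧-false (2 * (x % d) <? d) ¬p) (sym (cong (1 ∸_) (begin
    halves x % 2                              ≡⟨ cong (_% 2) (halves-decompose x) ⟩
    (2 * (x % d) / d + (x / d) * 2) % 2       ≡⟨ [m+kn]%n≡m%n (2 * (x % d) / d) (x / d) 2 ⟩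
    2 * (x % d) / d % 2                       ≡⟨ cong (_% 2) (≤-antisym
                                                   (s≤s⁻¹ (m<n*o⇒m/o<n {n = 2} (*-monoʳ-< 2 (m%n<n x d))))
                                                   (m≥n⇒m/n>0 (≮⇒≥ ¬p))) ⟩
    1                                         ∎)))
    where open ≡-Reasoning

  low-halves : ∀ {x y} → halves x ≡ halves y → low x ≡ low y
  low-halves {x} {y} eq = trans (low-parity x) (trans (cong (λ v → 1 ∸ v % 2) eq) (sym (low-parity y)))

  -- The discrete primitive of `low`: its increment over a window of length `r` is what `r * low x`
  -- approximates.
  ∑low : ℕ → ℕ
  ∑low x = ∑ x low

  ∑low-+d : ∀ x → ∑low (x + d) ≡ ∑low x + ∑low d
  ∑low-+d zero    = refl
  ∑low-+d (suc x) = trans (cong₂ _+_ (∑low-+d x) (low-+d x)) (lemma (∑low x) (∑low d) (low x))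
    where
    lemma : ∀ a b c → a + b + c ≡ a + c + b
    lemma = solve-∀

  ∑low-+*d : ∀ x m → ∑low (x + m * d) ≡ ∑low x + m * ∑low d
  ∑low-+*d x zero    = trans (cong ∑low (+-identityʳ x)) (sym (+-identityʳ _))
  ∑low-+*d x (suc m) = begin
    ∑low (x + (d + m * d))              ≡⟨ cong ∑low (lemma x d (m * d)) ⟩
    ∑low (x + m * d + d)                ≡⟨ ∑low-+d (x + m * d) ⟩
    ∑low (x + m * d) + ∑low d           ≡⟨ cong (_+ ∑low d) (∑low-+*d x m) ⟩
    ∑low x + m * ∑low d + ∑low d        ≡⟨ lemma (∑low x) (∑low d) (m * ∑low d) ⟨
    ∑low x + (∑low d + m * ∑low d)      ∎
    where
    open ≡-Reasoning
    lemma : ∀ a b c → a + (b + c) ≡ a + c + b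
    lemma = solve-∀

  ∑low-window : ∀ w e → ∑low (w + e) ≤ ∑low w + e
  ∑low-window w e = begin
    ∑low (w + e)                                ≡⟨ ∑-split w e low ⟩
    ∑low w + ∑ e (λ i → low (w + i))            ≤⟨ +-monoʳ-≤ (∑low w) (∑-mono e (λ i _ → low≤1 (w + i))) ⟩
    ∑low w + ∑ e (λ _ → 1)                      ≡⟨ cong (∑low w +_) (trans (∑-const e 1) (*-identityʳ e)) ⟩
    ∑low w + e                                  ∎
    where open ≤-Reasoning

  ∑low-mono : ∀ w e → ∑low w ≤ ∑low (w + e)
  ∑low-mono w e = subst (∑low w ≤_) (sym (∑-split w e low)) (m≤m+n _ _)

  -- Full periods contribute the same to both windows of length `y`; what remains of each has length
  -- `y % d`, at most `d`.
  ∑low-compare : ∀ w w′ y → ∑low (w′ + y) + ∑low w ≤ ∑low (w + y) + ∑low w′ + d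
  ∑low-compare w w′ y = begin
    ∑low (w′ + y) + ∑low w                       ≡⟨ cong (_+ ∑low w) (expand w′) ⟩
    ∑low (w′ + e) + m * ∑low d + ∑low w          ≤⟨ linear 0
        (+-mono-≤ (+-mono-≤ (∑low-window w′ e) (∑low-mono w e)) (m%n≤n y d))
        (lemma (∑low (w′ + e)) (m * ∑low d) (∑low w) (∑low w′) e (∑low (w + e)) d) ⟩
    ∑low (w + e) + m * ∑low d + ∑low w′ + d      ≡⟨ cong (λ z → z + ∑low w′ + d) (expand w) ⟨
    ∑low (w + y) + ∑low w′ + d                   ∎
    where
    open ≤-Reasoning
    e = y % d
    m = y / d
    expand : ∀ x → ∑low (x + y) ≡ ∑low (x + e) + m * ∑low d
    expand x = trans (cong ∑low (trans (cong (x +_) (m≡m%n+[m/n]*n y d)) (sym (+-assoc x e (m * d))))) (∑low-+*d (x + e) m)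
    lemma : ∀ a b c a′ f g k → a + b + c + (a′ + f + g + k) + 0 ≡ g + b + a′ + k + (a + c + f)
    lemma = solve-∀

  -- The quadrature error of one step is at most r times the number of half-periods crossed.
  module _ (r : ℕ) where

    window-constant : ∀ x → halves (x + r) ≡ halves x → ∑low (x + r) ≡ ∑low x + r * low x
    window-constant x eq = begin
      ∑low (x + r)                              ≡⟨ ∑-split x r low ⟩
      ∑low x + ∑ r (λ i → low (x + i))          ≡⟨ cong (∑low x +_) (∑-cong r λ i i<r → low-halves
                                                     (≤-antisym (≤-trans (halves-mono (+-monoʳ-≤ x (<⇒≤ i<r))) (≤-reflexive eq))
                                                                (halves-mono (m≤m+n x i)))) ⟩
      ∑low x + ∑ r (λ _ → low x)                ≡⟨ cong (∑low x +_) (∑-const r (low x)) ⟩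
      ∑low x + r * low x                        ∎
      where open ≡-Reasoning

    crossing : ∀ x → halves (x + r) ≡ halves x ⊎ suc (halves x) ≤ halves (x + r)
    crossing x with halves (x + r) ≟ halves x
    ... | yes eq = inj₁ eq
    ... | no neq = inj₂ (≤∧≢⇒< (halves-mono (m≤m+n x r)) (neq ∘ sym))

    -- Inside one half-period `low` is constant and the approximation is exact. Otherwise the error
    -- is at most `r`, and one crossing pays for it.
    step-upper : ∀ x → r * low x + (∑low x + r * halves x) ≤ ∑low (x + r) + r * halves (x + r)
    step-upper x with crossing x
    ... | inj₁ eq rewrite window-constant x eq | eq = ≤-reflexive (lemma (r * low x) (∑low x) (r * halves x))
      where
      lemma : ∀ a b c → a + (b + c) ≡ b + a + c
      lemma = solve-∀
    ... | inj₂ lt = linear 0 (+-mono-≤ (+-mono-≤ (*-monoʳ-≤ r (low≤1 x)) (∑low-mono x r)) (*-monoʳ-≤ r lt))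
                      (lemma r (low x) (∑low x) (∑low (x + r)) (halves x) (halves (x + r)))
      where
      lemma : ∀ r l a a′ h h′ → r * l + (a + r * h) + (r * 1 + a′ + r * h′) + 0 ≡ a′ + r * h′ + (r * l + a + r * (1 + h))
      lemma = solve-∀

    step-lower : ∀ x → ∑low (x + r) + r * halves x ≤ ∑low x + r * low x + r * halves (x + r)
    step-lower x with crossing x
    ... | inj₁ eq rewrite window-constant x eq | eq = ≤-refl
    ... | inj₂ lt = linear (r * low x) (+-mono-≤ (∑low-window x r) (*-monoʳ-≤ r lt))
                      (lemma r (low x) (∑low x) (∑low (x + r)) (halves x) (halves (x + r)))
      where
      lemma : ∀ r l a a′ h h′ → a′ + r * h + (a + r + r * h′) + r * l ≡ a + r * l + r * h′ + (a′ + r * (1 + h))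
      lemma = solve-∀

    hits : ℕ → ℕ → ℕ
    hits w K = ∑ K (λ k → low (w + k * r))

    advance : ∀ w k → w + suc k * r ≡ w + k * r + r
    advance w k = lemma w k r
      where
      lemma : ∀ w k r → w + (1 + k) * r ≡ w + k * r + r
      lemma = solve-∀

    -- Summing `step-upper` telescopes both `∑low` and `halves`, so the error is `r` for each
    -- crossing and not `r` for each step.
    hits-upper : ∀ w K → r * hits w K + (∑low w + r * halves w) ≤ ∑low (w + K * r) + r * halves (w + K * r)
    hits-upper w zero = ≤-reflexive (trans (cong (_+ (∑low w + r * halves w)) (*-zeroʳ r))
                                           (cong (λ x → ∑low x + r * halves x) (sym (+-identityʳ w))))
    hits-upper w (suc K) rewrite advance w K =
      linear 0 (+-mono-≤ (hits-upper w K) (step-upper (w + K * r)))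
        (lemma r (hits w K) (low (w + K * r)) (∑low w + r * halves w)
           (∑low (w + K * r) + r * halves (w + K * r)) (∑low (w + K * r + r) + r * halves (w + K * r + r)))
      where
      lemma : ∀ r n l p q s → r * (n + l) + p + (q + s) + 0 ≡ s + (r * n + p + (r * l + q))
      lemma = solve-∀

    hits-lower : ∀ w K → ∑low (w + K * r) + r * halves w ≤ ∑low w + r * hits w K + r * halves (w + K * r)
    hits-lower w zero = ≤-reflexive (cong₂ _+_
      (trans (cong ∑low (+-identityʳ w)) (sym (trans (cong (∑low w +_) (*-zeroʳ r)) (+-identityʳ (∑low w)))))
      (cong (λ x → r * halves x) (sym (+-identityʳ w))))
    hits-lower w (suc K) rewrite advance w K =
      linear 0 (+-mono-≤ (hits-lower w K) (step-lower (w + K * r)))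
        (lemma r (hits w K) (low (w + K * r)) (∑low w) (halves w)
           (∑low (w + K * r)) (r * halves (w + K * r)) (∑low (w + K * r + r)) (r * halves (w + K * r + r)))
      where
      lemma : ∀ r n l a h b p e q → e + r * h + (a + r * n + p + (b + r * l + q)) + 0 ≡ a + r * (n + l) + q + (b + r * h + (e + p))
      lemma = solve-∀

    halves-travel : ∀ w y → halves (w + y) * d ≤ halves w * d + (d + 2 * y)
    halves-travel w y = linear 0 (+-mono-≤ (halves-lower (w + y)) (halves-upper w))
                          (lemma (halves (w + y) * d) w y (halves w * d) d)
      where
      lemma : ∀ a w y b d → a + (2 * (w + y) + (d + b)) + 0 ≡ b + (d + 2 * y) + (a + 2 * w)
      lemma = solve-∀

    -- r d (N′ − N) ≤ d² + 2 r d + 4 K r² for N = hits w K and N′ = hits w′ K; the three terms are at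
    -- most 1, 2 and 4 times r d K / C.
    equidistribution : ∀ K C .{{_ : NonZero r}} .{{_ : NonZero C}} → C * r ≤ d → C * d ≤ K * r →
                       ∀ w w′ → C * hits w′ K ≤ C * hits w K + 7 * K
    equidistribution K C Cr≤d Cd≤Kr w w′ = *-cancelʳ-≤ _ _ (r * d) {{m*n≢0 r d}}
      (linear 0 (+-mono-≤ (*-monoʳ-≤ C main) (+-mono-≤ (+-mono-≤ bound₁ bound₂) bound₃))
        (lemma C (hits w′ K) (hits w K) r d K))
      where
      N = hits w K
      N′ = hits w′ K
      y = K * r
      N′≤N : r * N′ + r * halves w′ + r * halves w ≤ r * N + r * halves (w + y) + r * halves (w′ + y) + d
      N′≤N = linear 0 (+-mono-≤ (+-mono-≤ (hits-upper w′ K) (hits-lower w K)) (∑low-compare w w′ y))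
               (lemma₀ (r * N′) (r * halves w′) (r * halves w) (r * N) (r * halves (w + y)) (r * halves (w′ + y)) d
                 (∑low w′) (∑low w) (∑low (w′ + y)) (∑low (w + y)))
        where
        lemma₀ : ∀ n′ h′ h n j j′ d a′ a b′ b →
                 n′ + h′ + h + (b′ + j′ + (a + n + j) + (b + a′ + d)) + 0 ≡ n + j + j′ + d + (n′ + (a′ + h′) + (b + h) + (b′ + a))
        lemma₀ = solve-∀
      main : r * N′ * d ≤ r * N * d + (d * d + 2 * (r * d) + 4 * (K * r * r))
      main = linear 0 (+-mono-≤ (*-monoˡ-≤ d N′≤N) (*-monoʳ-≤ r (+-mono-≤ (halves-travel w y) (halves-travel w′ y))))
               (lemma₁ r N′ N d (halves w) (halves w′) (halves (w + y)) (halves (w′ + y)) K)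
        where
        lemma₁ : ∀ r n′ n d h h′ j j′ K →
                 r * n′ * d + ((r * n + r * j + r * j′ + d) * d + r * (h * d + (d + 2 * (K * r)) + (h′ * d + (d + 2 * (K * r))))) + 0
                   ≡ r * n * d + (d * d + 2 * (r * d) + 4 * (K * r * r)) + ((r * n′ + r * h′ + r * h) * d + r * (j * d + j′ * d))
        lemma₁ = solve-∀
      -- As `r ≤ d`, covering `C * d` takes at least `C` steps; this absorbs the middle error term.
      C≤K : C ≤ K
      C≤K = *-cancelʳ-≤ C K r (≤-trans (*-monoʳ-≤ C r≤d) Cd≤Kr)
        where
        r≤d : r ≤ d
        r≤d = ≤-trans (m≤n*m r C) Cr≤d
      bound₁ : C * d * d ≤ K * r * d
      bound₁ = *-monoˡ-≤ d Cd≤Kr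
      bound₂ : C * (2 * (r * d)) ≤ K * (2 * (r * d))
      bound₂ = *-monoˡ-≤ (2 * (r * d)) C≤K
      bound₃ : C * r * (4 * (K * r)) ≤ d * (4 * (K * r))
      bound₃ = *-monoˡ-≤ (4 * (K * r)) Cr≤d
      lemma : ∀ C N′ N r d K →
              C * N′ * (r * d) + (C * (r * N * d + (d * d + 2 * (r * d) + 4 * (K * r * r))) + (K * r * d + K * (2 * (r * d)) + d * (4 * (K * r)))) + 0
                ≡ (C * N + 7 * K) * (r * d) + (C * (r * N′ * d) + (C * d * d + C * (2 * (r * d)) + C * r * (4 * (K * r))))
      lemma = solve-∀

-- Relations modulo d

^-distribˡ-* : ∀ m n k → (m * n) ^ k ≡ m ^ k * n ^ k
^-distribˡ-* m n zero    = refl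
^-distribˡ-* m n (suc k) = trans (cong (m * n *_) (^-distribˡ-* m n k)) (lemma m n (m ^ k) (n ^ k))
  where
  lemma : ∀ a b c e → a * b * (c * e) ≡ a * c * (b * e)
  lemma = solve-∀

^-cancelˡ-≡ : ∀ k .{{_ : NonZero k}} {m n} → m ^ k ≡ n ^ k → m ≡ n
^-cancelˡ-≡ k {m} {n} eq = ≤-antisym (≮⇒≥ λ n<m → <-irrefl (sym eq) (^-monoˡ-< k n<m))
                                     (≮⇒≥ λ m<n → <-irrefl eq (^-monoˡ-< k m<n))

even-or-odd : ∀ n → (∃[ w ] n ≡ w * 2) ⊎ (∃[ w ] n ≡ 1 + w * 2)
even-or-odd zero = inj₁ (0 , refl)
even-or-odd (suc n) with even-or-odd n
... | inj₁ (w , eq) = inj₂ (w , cong suc eq)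
... | inj₂ (w , eq) = inj₁ (suc w , cong suc eq)

module Congruence (d : ℕ) .{{_ : NonZero d}} where

  infix 4 _≈_
  _≈_ : ℕ → ℕ → Set
  a ≈ b = a % d ≡ b % d

  +-cong-≈ : ∀ {a b c e} → a ≈ b → c ≈ e → a + c ≈ b + e
  +-cong-≈ {a} {b} {c} {e} p q =
    trans (%-distribˡ-+ a c d) (trans (cong₂ (λ x y → (x + y) % d) p q) (sym (%-distribˡ-+ b e d)))

  *-cong-≈ : ∀ {a b c e} → a ≈ b → c ≈ e → a * c ≈ b * e
  *-cong-≈ {a} {b} {c} {e} p q =
    trans (%-distribˡ-* a c d) (trans (cong₂ (λ x y → (x * y) % d) p q) (sym (%-distribˡ-* b e d)))

  *-congˡ-≈ : ∀ a {b c} → b ≈ c → a * b ≈ a * c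
  *-congˡ-≈ a = *-cong-≈ {a} refl

  ^-cong-≈ : ∀ k {a b} → a ≈ b → a ^ k ≈ b ^ k
  ^-cong-≈ zero    p = refl
  ^-cong-≈ (suc k) p = *-cong-≈ p (^-cong-≈ k p)

  %-≈ : ∀ a → a % d ≈ a
  %-≈ a = m%n%n≡m%n a d

  +-multiple-≈ : ∀ a k → a + k * d ≈ a
  +-multiple-≈ a k = [m+kn]%n≡m%n a k d

  -- Adding `pred d * c` completes `c` to the multiple `c * d`, in place of subtracting `c`.
  +-cancelʳ-≈ : ∀ c {a b} → a + c ≈ b + c → a ≈ b
  +-cancelʳ-≈ c {a} {b} p = trans (sym (complete a)) (trans (+-cong-≈ {c = pred d * c} p refl) (complete b))
    where
    lemma : ∀ x c e → x + c + e * c ≡ x + c * (1 + e)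
    lemma = solve-∀
    complete : ∀ x → x + c + pred d * c ≈ x
    complete x = trans (cong (_% d) (trans (lemma x c (pred d)) (cong (λ z → x + c * z) (suc-pred d)))) (+-multiple-≈ x c)

  <⇒≈⇒≡ : ∀ {a b} → a < d → b < d → a ≈ b → a ≡ b
  <⇒≈⇒≡ a<d b<d p = trans (sym (m<n⇒m%n≡m a<d)) (trans p (m<n⇒m%n≡m b<d))

  ≈0⇒∣ : ∀ {a} → a ≈ 0 → d ∣ a
  ≈0⇒∣ {a} p = m%n≡0⇒n∣m a d (trans p (m*n%n≡0 0 d))

  ∣⇒≈0 : ∀ {a} → d ∣ a → a ≈ 0
  ∣⇒≈0 {a} p = trans (n∣m⇒m%n≡0 a d p) (sym (m*n%n≡0 0 d))

  ≈⇒∣∸ : ∀ {a b} → a ≤ b → b ≈ a → d ∣ b ∸ a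
  ≈⇒∣∸ {a} {b} a≤b p = ≈0⇒∣ (+-cancelʳ-≈ a (trans (cong (_% d) (m∸n+n≡m a≤b)) p))

  ∣∸⇒≈ : ∀ {a b} → a ≤ b → d ∣ b ∸ a → b ≈ a
  ∣∸⇒≈ {a} {b} a≤b p = trans (cong (_% d) (sym (m∸n+n≡m a≤b))) (+-cong-≈ {c = a} (∣⇒≈0 p) refl)

  coprime-cancel-≈ : ∀ {u} → Coprime u d → ∀ {x y} → u * x ≈ u * y → x ≈ y
  coprime-cancel-≈ {u} cop {x} {y} p = [ (λ x≤y → sym (go x≤y (sym p))) , (λ y≤x → go y≤x p) ]′ (≤-total x y)
    where
    go : ∀ {x y} → x ≤ y → u * y ≈ u * x → y ≈ x
    go {x} {y} x≤y p = ∣∸⇒≈ x≤y (coprime-divisor (Coprimality.sym cop)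
      (subst (d ∣_) (sym (*-distribˡ-∸ u y x)) (≈⇒∣∸ (*-monoʳ-≤ u x≤y) p)))

  infix 4 _≈±_
  -- The second alternative is `a ≡ −r`, written without negatives.
  _≈±_ : ℕ → ℕ → Set
  a ≈± r = a ≈ r ⊎ a + r ≈ 0

  -- Pigeonhole: the residues of `k * θ` for the `C + 1` values `k ≤ C` fall into `C` boxes of
  -- length `d / C`. Two in one box give `q` as the difference of their indices, and their order
  -- gives the sign.
  dirichlet : ∀ C .{{_ : NonZero C}} θ → ∃₂ λ q r → 1 ≤ q × q ≤ C × C * r ≤ d × q * θ ≈± r
  dirichlet C θ = conclude (pigeonhole (n<1+n C) (λ k → fromℕ< (box<C (toℕ k))))
    where
    pos : ℕ → ℕ
    pos k = k * θ % d
    box : ℕ → ℕ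
    box k = C * pos k / d
    box<C : ∀ k → box k < C
    box<C k = m<n*o⇒m/o<n {n = C} (*-monoʳ-< C (m%n<n (k * θ) d))
    near : ∀ i j → box i ≡ box j → C * (pos j ∸ pos i) ≤ d
    near i j eq = begin
      C * (pos j ∸ pos i)                                 ≡⟨ *-distribˡ-∸ C (pos j) (pos i) ⟩
      C * pos j ∸ C * pos i                               ≤⟨ ∸-monoˡ-≤ (C * pos i) (≤-reflexive (m≡m%n+[m/n]*n (C * pos j) d)) ⟩
      (C * pos j) % d + box j * d ∸ C * pos i             ≤⟨ ∸-monoˡ-≤ (C * pos i) (+-mono-≤ (m%n≤n (C * pos j) d)
                                                               (subst (λ b → b * d ≤ C * pos i) eq (m/n*n≤m (C * pos i) d))) ⟩
      d + C * pos i ∸ C * pos i                           ≡⟨ m+n∸n≡m d (C * pos i) ⟩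
      d                                                   ∎
      where open ≤-Reasoning
    conclude : (∃₂ λ (i j : Fin (suc C)) → i Data.Fin.< j × fromℕ< (box<C (toℕ i)) ≡ fromℕ< (box<C (toℕ j))) →
             ∃₂ λ q r → 1 ≤ q × q ≤ C × C * r ≤ d × q * θ ≈± r
    conclude (i′ , j′ , i<j , eq) = q , [ up , down ]′ (≤-total (pos i) (pos j))
      where
      i = toℕ i′
      j = toℕ j′
      q = j ∸ i
      box-eq : box i ≡ box j
      box-eq = fromℕ<-injective _ _ (box<C i) (box<C j) eq
      1≤q : 1 ≤ q
      1≤q = m<n⇒0<n∸m i<j
      q≤C : q ≤ C
      q≤C = ≤-trans (m∸n≤m j i) (s≤s⁻¹ (toℕ<n j′))
      qθ : q * θ + i * θ ≡ j * θ
      qθ = trans (sym (*-distribʳ-+ θ q i)) (cong (_* θ) (m∸n+n≡m (<⇒≤ i<j)))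
      up : pos i ≤ pos j → ∃[ r ] (1 ≤ q × q ≤ C × C * r ≤ d × q * θ ≈± r)
      up le = pos j ∸ pos i , 1≤q , q≤C , near i j box-eq , inj₁ (+-cancelʳ-≈ (i * θ) (begin
        (q * θ + i * θ) % d                ≡⟨ cong (_% d) qθ ⟩
        j * θ % d                          ≡⟨ %-≈ (j * θ) ⟨
        pos j % d                          ≡⟨ cong (_% d) (m∸n+n≡m le) ⟨
        (pos j ∸ pos i + pos i) % d        ≡⟨ +-cong-≈ {pos j ∸ pos i} refl (%-≈ (i * θ)) ⟩
        (pos j ∸ pos i + i * θ) % d        ∎))
        where open ≡-Reasoning
      down : pos j ≤ pos i → ∃[ r ] (1 ≤ q × q ≤ C × C * r ≤ d × q * θ ≈± r)
      down le = pos i ∸ pos j , 1≤q , q≤C , near j i (sym box-eq) , inj₂ (+-cancelʳ-≈ (pos j) (begin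
        (q * θ + (pos i ∸ pos j) + pos j) % d       ≡⟨ cong (_% d) (trans (+-assoc (q * θ) _ _) (cong (q * θ +_) (m∸n+n≡m le))) ⟩
        (q * θ + pos i) % d                         ≡⟨ +-cong-≈ {q * θ} refl (%-≈ (i * θ)) ⟩
        (q * θ + i * θ) % d                         ≡⟨ cong (_% d) qθ ⟩
        j * θ % d                                   ≡⟨ %-≈ (j * θ) ⟨
        pos j % d                                   ∎))
        where open ≡-Reasoning

  ≈±-square : ∀ {a r} → a ≈± r → a * a ≈ r * r
  ≈±-square         (inj₁ p) = *-cong-≈ p p
  ≈±-square {a} {r} (inj₂ p) = +-cancelʳ-≈ (a * r) (begin
    (a * a + a * r) % d       ≡⟨ cong (_% d) (*-distribˡ-+ a a r) ⟨
    (a * (a + r)) % d         ≡⟨ *-congˡ-≈ a p ⟩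
    (a * 0) % d               ≡⟨ cong (_% d) (trans (*-zeroʳ a) (sym (*-zeroʳ r))) ⟩
    (r * 0) % d               ≡⟨ *-congˡ-≈ r p ⟨
    (r * (a + r)) % d         ≡⟨ cong (_% d) (trans (*-distribˡ-+ r a r) (trans (+-comm (r * a) (r * r)) (cong (r * r +_) (*-comm r a)))) ⟩
    (r * r + a * r) % d       ∎)
    where open ≡-Reasoning

  -- Squaring removes the sign and the `m`th power removes `h`. Both sides then lie below `d`, so
  -- the congruence is an equality and roots can be taken in the naturals.
  short-relation : ∀ {h m a r} .{{_ : NonZero m}} → h ^ m ≈ 1 → a * h ≈± r → (a * a) ^ m < d → (r * r) ^ m < d → a ≡ r
  short-relation {h} {m} {a} {r} ord rel a<d r<d = ^-cancelˡ-≡ 2 (trans (square a) (trans (^-cancelˡ-≡ m (<⇒≈⇒≡ a<d r<d (begin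
    (a * a) ^ m % d                             ≡⟨ cong (_% d) (*-identityʳ ((a * a) ^ m)) ⟨
    ((a * a) ^ m * 1) % d                       ≡⟨ *-congˡ-≈ ((a * a) ^ m) (trans (sym (*-cong-≈ {h ^ m} {1} ord ord)) (cong (_% d) (sym (^-distribˡ-* h h m)))) ⟩
    ((a * a) ^ m * (h * h) ^ m) % d             ≡⟨ cong (_% d) (trans (sym (^-distribˡ-* (a * a) (h * h) m)) (cong (_^ m) (lemma a h))) ⟩
    ((a * h) * (a * h)) ^ m % d                 ≡⟨ ^-cong-≈ m (≈±-square rel) ⟩
    (r * r) ^ m % d                             ∎))) (sym (square r))))
    where
    open ≡-Reasoning
    square : ∀ x → x ^ 2 ≡ x * x
    square x = cong (x *_) (*-identityʳ x)
    lemma : ∀ a h → a * a * (h * h) ≡ a * h * (a * h)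
    lemma = solve-∀

  open Low d

  module _ {θ q r : ℕ} where

    progression-hits : q * θ ≈± r → ∀ K w i → ∃[ W ] ∑ K (λ k → low (w + (k * q + i) * θ)) ≡ hits r W K
    progression-hits (inj₁ p) K w i = w + i * θ , ∑-cong K λ k _ → low-cong (begin
      (w + (k * q + i) * θ) % d             ≡⟨ cong (_% d) (lemma w k q i θ) ⟩
      (w + i * θ + k * (q * θ)) % d         ≡⟨ +-cong-≈ {w + i * θ} refl (*-congˡ-≈ k p) ⟩
      (w + i * θ + k * r) % d               ∎)
      where
      open ≡-Reasoning
      lemma : ∀ w k q i θ → w + (k * q + i) * θ ≡ w + i * θ + k * (q * θ)
      lemma = solve-∀
    progression-hits (inj₂ p) K w i = W , trans (∑-cong K (λ k k<K → low-cong (descend k k<K))) (∑-reverse K (λ k → low (W + k * r)))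
      where
      open ≡-Reasoning
      -- Congruent to the last term, since `q * θ + r ≡ 0`. Read backwards from there, the
      -- progression has step `+ r`.
      W = w + i * θ + K * (q * θ) + r
      lemma : ∀ w k q i θ r e → w + i * θ + (1 + k + e) * (q * θ) + r + e * r
                                ≡ w + (k * q + i) * θ + (1 + e) * (q * θ + r)
      lemma = solve-∀
      descend : ∀ k → k < K → w + (k * q + i) * θ ≈ W + (K ∸ suc k) * r
      descend k k<K = sym (begin
        (W + e * r) % d                                                    ≡⟨ cong (λ z → (w + i * θ + z * (q * θ) + r + e * r) % d) (m+[n∸m]≡n k<K) ⟨
        (w + i * θ + (1 + k + e) * (q * θ) + r + e * r) % d                ≡⟨ cong (_% d) (lemma w k q i θ r e) ⟩
        (w + (k * q + i) * θ + (1 + e) * (q * θ + r)) % d                  ≡⟨ +-cong-≈ {w + (k * q + i) * θ} refl (*-congˡ-≈ (1 + e) p) ⟩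
        (w + (k * q + i) * θ + (1 + e) * 0) % d                            ≡⟨ cong (_% d) (trans (cong (w + (k * q + i) * θ +_) (*-zeroʳ (1 + e))) (+-identityʳ _)) ⟩
        (w + (k * q + i) * θ) % d                                          ∎)
        where e = K ∸ suc k

    -- It is `q * θ`, rather than `θ`, that is close to a multiple of `d`. Splitting the index by
    -- its residue mod `q` leaves `q` progressions of step `± r`, each with `K` terms.
    progression-equidistribution : q * θ ≈± r → ∀ K C .{{_ : NonZero r}} .{{_ : NonZero C}} → C * r ≤ d → C * d ≤ K * r → ∀ w w′ →
      C * ∑ (K * q) (λ k → low (w′ + k * θ)) ≤ C * ∑ (K * q) (λ k → low (w + k * θ)) + 7 * (K * q)
    progression-equidistribution rel K C Cr≤d Cd≤Kr w w′ = begin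
      C * ∑ (K * q) (λ k → low (w′ + k * θ))                                    ≡⟨ cong (C *_) (classes w′) ⟩
      C * ∑ q (count w′)                                                        ≡⟨ ∑-* q C (count w′) ⟨
      ∑ q (λ i → C * count w′ i)                                                ≤⟨ ∑-mono q (λ i _ → class-bound i) ⟩
      ∑ q (λ i → C * count w i + 7 * K)                                         ≡⟨ ∑-+ q (λ i → C * count w i) (λ _ → 7 * K) ⟩
      ∑ q (λ i → C * count w i) + ∑ q (λ _ → 7 * K)                             ≡⟨ cong₂ _+_ (∑-* q C (count w)) (trans (∑-const q (7 * K)) (lemma q K)) ⟩
      C * ∑ q (count w) + 7 * (K * q)                                           ≡⟨ cong (λ z → C * z + 7 * (K * q)) (classes w) ⟨
      C * ∑ (K * q) (λ k → low (w + k * θ)) + 7 * (K * q)                       ∎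
      where
      open ≤-Reasoning
      count : ℕ → ℕ → ℕ
      count w i = ∑ K (λ k → low (w + (k * q + i) * θ))
      classes : ∀ w → ∑ (K * q) (λ k → low (w + k * θ)) ≡ ∑ q (count w)
      classes w = trans (∑-blocks K q _) (∑-swap K q _)
      lemma : ∀ q K → q * (7 * K) ≡ 7 * (K * q)
      lemma = solve-∀
      class-bound : ∀ i → C * count w′ i ≤ C * count w i + 7 * K
      class-bound i = let (W′ , eq′) = progression-hits rel K w′ i ; (W , eq) = progression-hits rel K w i in
        subst₂ (λ x y → C * x ≤ C * y + 7 * K) (sym eq′) (sym eq) (equidistribution r K C Cr≤d Cd≤Kr W W′)

-- Exponents that annihilate elements of a subgroup

module _ {d : ℕ} .{{_ : NonZero d}} {H : List ℕ} (sub : IsSubgroup d H) where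
  open IsSubgroup sub
  open Congruence d

  power∈ : ∀ {h} → h ∈ H → ∀ k → h ^ k % d ∈ H
  power∈ h∈ zero    = one∈
  power∈ {h} h∈ (suc k) = subst (_∈ H) (*-congˡ-≈ h (%-≈ (h ^ k))) (mul∈ h∈ (power∈ h∈ k))

  -- Two of the `length H + 1` powers `h ^ 0, h ^ 1, …` coincide in `H`; a power of the inverse `b`
  -- cancels the smaller one.
  order-bound : ∀ {h} → h ∈ H → ∃[ m ] (1 ≤ m × m ≤ length H × h ^ m ≈ 1)
  order-bound {h} h∈ with pigeonhole (n<1+n (length H)) (λ k → index (power∈ h∈ (toℕ k))) | inv∈ h∈
  ... | (i′ , j′ , i<j , eq) | (b , _ , hb≈1) = j ∸ i , m<n⇒0<n∸m i<j , ≤-trans (m∸n≤m j i) (s≤s⁻¹ (toℕ<n j′)) , (begin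
      h ^ m % d                              ≡⟨ cong (_% d) (*-identityˡ (h ^ m)) ⟨
      (1 * h ^ m) % d                        ≡⟨ *-cong-≈ {1} (sym inverse) refl ⟩
      (b ^ i * h ^ i * h ^ m) % d            ≡⟨ cong (_% d) (trans (*-assoc (b ^ i) (h ^ i) (h ^ m)) (cong (b ^ i *_)
                                                  (trans (sym (^-distribˡ-+-* h i m)) (cong (h ^_) (m+[n∸m]≡n (<⇒≤ i<j)))))) ⟩
      (b ^ i * h ^ j) % d                    ≡⟨ *-congˡ-≈ (b ^ i) (sym same) ⟩
      (b ^ i * h ^ i) % d                    ≡⟨ inverse ⟩
      1 % d                                  ∎)
    where
    open ≡-Reasoning
    i = toℕ i′
    j = toℕ j′
    m = j ∸ i
    same : h ^ i ≈ h ^ j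
    same = trans (lookup-index (power∈ h∈ i)) (trans (cong (lookup H) eq) (sym (lookup-index (power∈ h∈ j))))
    inverse : b ^ i * h ^ i ≈ 1
    inverse = begin
      (b ^ i * h ^ i) % d        ≡⟨ cong (_% d) (trans (*-comm (b ^ i) (h ^ i)) (sym (^-distribˡ-* h b i))) ⟩
      (h * b) ^ i % d            ≡⟨ ^-cong-≈ i hb≈1 ⟩
      1 ^ i % d                  ≡⟨ cong (_% d) (^-zeroˡ i) ⟩
      1 % d                      ∎

-- Elements that fix or negate a short step

module _ {d : ℕ} .{{_ : NonZero d}} where
  open Congruence d
  open Low d

  -- The distance from `g` to `d` is at most `t`, and `e` times it is a multiple of `d` smaller than
  -- `d`, so it vanishes.
  near-modulus : ∀ {e g t} .{{_ : NonZero e}} → d ∣ e * g → e * t < d → g ≤ d + t → d ≤ g + t → g ≡ d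
  near-modulus {e} {g} {t} d∣eg et<d g≤d+t d≤g+t =
    [ (λ g≤d → ≤-antisym g≤d (m∸n≡0⇒m≤n (vanish (d ∸ g) (m≤n+o⇒m∸n≤o d g d≤g+t)
        (subst (d ∣_) (sym (*-distribˡ-∸ e d g)) (≈⇒∣∸ (*-monoʳ-≤ e g≤d) (trans (∣⇒≈0 (n∣m*n e)) (sym (∣⇒≈0 d∣eg))))))))
    , (λ d≤g → ≤-antisym (m∸n≡0⇒m≤n (vanish (g ∸ d) (m≤n+o⇒m∸n≤o g d g≤d+t)
        (subst (d ∣_) (sym (*-distribˡ-∸ e g d)) (≈⇒∣∸ (*-monoʳ-≤ e d≤g) (trans (∣⇒≈0 d∣eg) (sym (∣⇒≈0 (n∣m*n e)))))))) d≤g)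
    ]′ (≤-total g d)
    where
    vanish : ∀ x → x ≤ t → d ∣ e * x → x ≡ 0
    vanish zero    _   _ = refl
    vanish (suc x) x≤t p = ⊥-elim (<⇒≱ et<d (≤-trans (∣⇒≤ {{m*n≢0 e (suc x)}} p) (*-monoʳ-≤ e x≤t)))

  -- If u h and (u + s) h lie in different halves, then x = u h % d differs from d − u or from
  -- u + d/2 by at most s.  As d divides e times that difference (or twice it), the difference is 0.
  module _ {e s u h : ℕ} .{{_ : NonZero e}} (e∣s : e ∣ s) (cop-u : Coprime u d) (unit-h : IsUnit d h) (2<d : 2 < d)
           (2u<d : 2 * u < d) (d≤2v : d ≤ 2 * (u + s)) (2es<d : 2 * (e * s) < d) where

    private
      x = u * h % d
      z = (u + s) * h % d
      k = quotient e∣s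
      s≤es : s ≤ e * s
      s≤es = m≤n*m s e
      2s<d : 2 * s < d
      2s<d = ≤-<-trans (*-monoʳ-≤ 2 s≤es) 2es<d

    flip-minus : e * h + e ≈ 0 → 2 * z < d → d ≤ 2 * x → h ≡ d ∸ 1
    flip-minus p 2z<d d≤2x = cong pred (near-modulus {1} {suc h} {0}
        (≈0⇒∣ (trans (cong (_% d) (+-identityʳ (suc h))) 1+h≈0))
        (≤-<-trans z≤n 2<d)
        (≤-trans (proj₁ unit-h) (m≤m+n d 0))
        (≤-trans (∣⇒≤ (≈0⇒∣ 1+h≈0)) (m≤m+n (suc h) 0)))
      where
      open ≡-Reasoning
      lemma₁ : ∀ u k e h → (u + k * e) * h + k * e ≡ u * h + k * (e * h + e)
      lemma₁ = solve-∀
      lemma₂ : ∀ u e h → e * (u * h + u) ≡ u * (e * h + e)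
      lemma₂ = solve-∀
      -- As `s` is a multiple of `e`, the relation `e h ≡ −e` gives `s h ≡ −s`.
      z+s≈x : z + s ≈ x
      z+s≈x = begin
        (z + s) % d                                       ≡⟨ +-cong-≈ {z} (%-≈ ((u + s) * h)) refl ⟩
        ((u + s) * h + s) % d                             ≡⟨ cong (λ t → ((u + t) * h + t) % d) (m∣n⇒n≡quotient*m e∣s) ⟩
        ((u + k * e) * h + k * e) % d                     ≡⟨ cong (_% d) (lemma₁ u k e h) ⟩
        (u * h + k * (e * h + e)) % d                     ≡⟨ +-cong-≈ {u * h} refl (*-congˡ-≈ k p) ⟩
        (u * h + k * 0) % d                               ≡⟨ cong (_% d) (trans (cong (u * h +_) (*-zeroʳ k)) (+-identityʳ _)) ⟩
        (u * h) % d                                       ≡⟨ %-≈ (u * h) ⟨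
        x % d                                             ∎
      -- Both `z` and `s` are below d/2, so nothing wraps around.
      z+s≡x : z + s ≡ x
      z+s≡x = <⇒≈⇒≡ (*-cancelˡ-< 2 (z + s) d (subst (_< 2 * d) (sym (*-distribˡ-+ 2 z s))
                       (subst (2 * z + 2 * s <_) (cong (d +_) (sym (+-identityʳ d))) (+-mono-< 2z<d 2s<d))))
                     (m%n<n (u * h) d) z+s≈x
      -- With `z` and `u` below d/2 and `x = z + s`, the sum is at most `d + s`; with `x` and
      -- `u + s` at least d/2, it is at least `d − s`.
      x+u≡d : x + u ≡ d
      x+u≡d = near-modulus {e} {x + u} {s}
        (≈0⇒∣ (begin
          (e * (x + u)) % d             ≡⟨ *-congˡ-≈ e (+-cong-≈ {x} (%-≈ (u * h)) refl) ⟩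
          (e * (u * h + u)) % d         ≡⟨ cong (_% d) (lemma₂ u e h) ⟩
          (u * (e * h + e)) % d         ≡⟨ *-congˡ-≈ u p ⟩
          (u * 0) % d                   ≡⟨ cong (_% d) (*-zeroʳ u) ⟩
          0 % d                         ∎))
        (≤-<-trans (m≤n*m (e * s) 2) 2es<d)
        (*-cancelˡ-≤ 2 (linear 0 (+-mono-≤ (+-mono-≤ (<⇒≤ 2z<d) (<⇒≤ 2u<d)) (≤-reflexive (cong (2 *_) (sym z+s≡x))))
           (lemma₃ x u d s z)))
        (*-cancelˡ-≤ 2 (linear 0 (+-mono-≤ d≤2x d≤2v) (lemma₄ x u d s)))
        where
        lemma₃ : ∀ x u d s z → 2 * (x + u) + (d + d + 2 * (z + s)) + 0 ≡ 2 * (d + s) + (2 * z + 2 * u + 2 * x)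
        lemma₃ = solve-∀
        lemma₄ : ∀ x u d s → 2 * d + (2 * x + 2 * (u + s)) + 0 ≡ 2 * (x + u + s) + (d + d)
        lemma₄ = solve-∀
      1+h≈0 : suc h ≈ 0
      1+h≈0 = coprime-cancel-≈ cop-u (begin
        (u * suc h) % d         ≡⟨ cong (_% d) (trans (*-suc u h) (+-comm u (u * h))) ⟩
        (u * h + u) % d         ≡⟨ +-cong-≈ {u * h} (sym (%-≈ (u * h))) refl ⟩
        (x + u) % d             ≡⟨ trans (cong (_% d) x+u≡d) (trans (n%n≡0 d) (sym (m*n%n≡0 0 d))) ⟩
        0 % d                   ≡⟨ cong (_% d) (*-zeroʳ u) ⟨
        (u * 0) % d             ∎)

    flip-plus : e * h ≈ e → 2 * z < d → d ≤ 2 * x → (4 ∣ d) × h ≡ d / 2 + 1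
    flip-plus p 2z<d d≤2x = 4∣d , trans h≡1+δ (trans (+-comm 1 δ) (cong (_+ 1) (sym d/2≡δ)))
      where
      open ≡-Reasoning
      δ = x ∸ u
      u≤x : u ≤ x
      u≤x = *-cancelˡ-≤ 2 (≤-trans (<⇒≤ 2u<d) d≤2x)
      lemma₁ : ∀ u k e h → (u + k * e) * h ≡ u * h + k * (e * h)
      lemma₁ = solve-∀
      lemma₂ : ∀ u e h → e * (u * h) ≡ u * (e * h)
      lemma₂ = solve-∀
      x+s≈z : x + s ≈ z
      x+s≈z = sym (begin
        z % d                                       ≡⟨ %-≈ ((u + s) * h) ⟩
        ((u + s) * h) % d                           ≡⟨ cong (λ t → ((u + t) * h) % d) (m∣n⇒n≡quotient*m e∣s) ⟩
        ((u + k * e) * h) % d                       ≡⟨ cong (_% d) (lemma₁ u k e h) ⟩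
        (u * h + k * (e * h)) % d                   ≡⟨ +-cong-≈ {u * h} refl (*-congˡ-≈ k p) ⟩
        (u * h + k * e) % d                         ≡⟨ +-cong-≈ {u * h} (sym (%-≈ (u * h))) (cong (_% d) (sym (m∣n⇒n≡quotient*m e∣s))) ⟩
        (x + s) % d                                 ∎)
      -- Here `x` is in the upper half and `z` in the lower, so `x + s ≡ z` has to wrap around.
      d≤x+s : d ≤ x + s
      d≤x+s = ≮⇒≥ λ x+s<d → <⇒≱ 2z<d (≤-trans d≤2x (*-monoʳ-≤ 2
        (≤-trans (m≤m+n x s) (≤-reflexive (<⇒≈⇒≡ x+s<d (m%n<n ((u + s) * h) d) x+s≈z)))))
      x≡u+δ : x ≡ u + δ
      x≡u+δ = sym (m+[n∸m]≡n u≤x)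
      d∣eδ : d ∣ e * δ
      d∣eδ = subst (d ∣_) (sym (*-distribˡ-∸ e x u)) (≈⇒∣∸ (*-monoʳ-≤ e u≤x) (begin
        (e * x) % d                ≡⟨ *-congˡ-≈ e (%-≈ (u * h)) ⟩
        (e * (u * h)) % d          ≡⟨ cong (_% d) (lemma₂ u e h) ⟩
        (u * (e * h)) % d          ≡⟨ *-congˡ-≈ u p ⟩
        (u * e) % d                ≡⟨ cong (_% d) (*-comm u e) ⟩
        (e * u) % d                ∎))
      lemma₀ : ∀ e δ → 2 * (e * δ) ≡ e * (δ * 2)
      lemma₀ = solve-∀
      -- Now `x` is within `s` of `d` and `u` within `s` of d/2, both from below, so `δ` is within
      -- `s` of d/2. Doubling it doubles the tolerance, which is why `2 * (e * s) < d` is assumed.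
      d≡2δ : δ * 2 ≡ d
      d≡2δ = near-modulus {e} {δ * 2} {2 * s}
        (subst (d ∣_) (lemma₀ e δ) (∣n⇒∣m*n 2 d∣eδ))
        (subst (_< d) (trans (lemma₀ e s) (cong (e *_) (*-comm s 2))) 2es<d)
        (linear 0 (+-mono-≤ (+-mono-≤ (≤-reflexive (cong (2 *_) (sym x≡u+δ))) d≤2v) (*-monoʳ-≤ 2 (<⇒≤ (m%n<n (u * h) d)))) (lemma₃ u δ d s x))
        (linear 0 (+-mono-≤ (+-mono-≤ (≤-reflexive (cong (2 *_) x≡u+δ)) (<⇒≤ 2u<d)) (*-monoʳ-≤ 2 d≤x+s)) (lemma₄ u δ d s x))
        where
        lemma₃ : ∀ u δ d s x → δ * 2 + (2 * x + 2 * (u + s) + 2 * d) + 0 ≡ d + 2 * s + (2 * (u + δ) + d + 2 * x)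
        lemma₃ = solve-∀
        lemma₄ : ∀ u δ d s x → d + (2 * (u + δ) + d + 2 * (x + s)) + 0 ≡ δ * 2 + 2 * s + (2 * x + 2 * u + 2 * d)
        lemma₄ = solve-∀
      d/2≡δ : d / 2 ≡ δ
      d/2≡δ = trans (/-congˡ (sym d≡2δ)) (m*n/n≡m δ 2)
      2∣d : 2 ∣ d
      2∣d = divides δ (sym d≡2δ)
      odd : ∀ {a} → Coprime a d → ∃[ w ] a ≡ 1 + w * 2
      odd {a} cop with even-or-odd a
      ... | inj₂ o = o
      ... | inj₁ (w , eq) = ⊥-elim (contradiction (cop {2} (divides w eq , 2∣d)) λ ())
      1<δ : 1 < δ
      1<δ = *-cancelʳ-< 2 1 δ (subst (2 <_) (sym d≡2δ) 2<d)
      1+δ<d : 1 + δ < d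
      1+δ<d = subst (1 + δ <_) (trans (lemma₅ δ) d≡2δ) (+-monoˡ-< δ 1<δ)
        where
        lemma₅ : ∀ δ → δ + δ ≡ δ * 2
        lemma₅ = solve-∀
      -- Being prime to the even `d`, `u` is odd; hence `u δ ≡ δ` modulo `d = 2 δ`, and
      -- `u + δ ≡ u (1 + δ)`.
      h≡1+δ : h ≡ 1 + δ
      h≡1+δ = <⇒≈⇒≡ (proj₁ unit-h) 1+δ<d (coprime-cancel-≈ cop-u (begin
        (u * h) % d                             ≡⟨ %-≈ (u * h) ⟨
        x % d                                   ≡⟨ cong (_% d) x≡u+δ ⟩
        (u + δ) % d                             ≡⟨ +-multiple-≈ (u + δ) w ⟨
        (u + δ + w * d) % d                     ≡⟨ cong (λ t → (u + δ + w * t) % d) d≡2δ ⟨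
        (u + δ + w * (δ * 2)) % d               ≡⟨ cong (λ t → (t + δ + w * (δ * 2)) % d) u≡ ⟩
        (1 + w * 2 + δ + w * (δ * 2)) % d       ≡⟨ cong (_% d) (lemma₅ w δ) ⟩
        ((1 + w * 2) * (1 + δ)) % d             ≡⟨ cong (λ t → (t * (1 + δ)) % d) u≡ ⟨
        (u * (1 + δ)) % d                       ∎))
        where
        w = proj₁ (odd cop-u)
        u≡ = proj₂ (odd cop-u)
        lemma₅ : ∀ w δ → 1 + w * 2 + δ + w * (δ * 2) ≡ (1 + w * 2) * (1 + δ)
        lemma₅ = solve-∀
      -- The unit `h = 1 + δ` is odd too, so `δ`, which is d/2, is even.
      4∣d : 4 ∣ d
      4∣d with odd (proj₂ unit-h)
      ... | w , h≡ = divides w (begin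
        d              ≡⟨ d≡2δ ⟨
        δ * 2          ≡⟨ cong (_* 2) (suc-injective (trans (sym h≡1+δ) h≡)) ⟩
        w * 2 * 2      ≡⟨ *-assoc w 2 2 ⟩
        w * 4          ∎)

    -- A strict increase is what could offset the loss at `h = 1`; by `flip-minus` and `flip-plus`
    -- only the two excluded elements achieve it.
    low-shift : e * h ≈± e → ¬ h ≡ d ∸ 1 → ¬ ((4 ∣ d) × h ≡ d / 2 + 1) → low ((u + s) * h) ≤ low (u * h)
    low-shift rel h≢-1 h≢ with 2 * z <? d | 2 * x <? d
    ... | no 2z≮d | _ = ≤-trans (≤-reflexive (⟦⟧-false (2 * z <? d) 2z≮d)) z≤n
    ... | yes _ | yes 2x<d = ≤-trans (low≤1 ((u + s) * h)) (≤-reflexive (sym (⟦⟧-true (2 * x <? d) 2x<d)))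
    ... | yes 2z<d | no 2x≮d = ⊥-elim ([ (λ p → h≢ (flip-plus p 2z<d (≮⇒≥ 2x≮d))) , (λ p → h≢-1 (flip-minus p 2z<d (≮⇒≥ 2x≮d))) ]′ rel)

-- Sums over lists

∑ˡ : ∀ {a} {A : Set a} → (A → ℕ) → List A → ℕ
∑ˡ f xs = sum (map f xs)

∑-∑ˡ-swap : ∀ {a} {A : Set a} n (f : ℕ → A → ℕ) xs → ∑ n (λ k → ∑ˡ (f k) xs) ≡ ∑ˡ (λ x → ∑ n (λ k → f k x)) xs
∑-∑ˡ-swap n f []       = trans (∑-const n 0) (*-zeroʳ n)
∑-∑ˡ-swap n f (x ∷ xs) = trans (∑-+ n (λ k → f k x) (λ k → ∑ˡ (f k) xs)) (cong (∑ n (λ k → f k x) +_) (∑-∑ˡ-swap n f xs))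

∑ˡ-bound : ∀ {a} {A : Set a} {c} {f : A → ℕ} {xs} → (∀ {x} → x ∈ xs → f x ≤ c) → ∑ˡ f xs ≤ length xs * c
∑ˡ-bound {xs = []}     le = z≤n
∑ˡ-bound {xs = x ∷ xs} le = +-mono-≤ (le (here refl)) (∑ˡ-bound {xs = xs} (le ∘ there))

∈⇒≤∑ˡ : ∀ {a} {A : Set a} (f : A → ℕ) {x xs} → x ∈ xs → f x ≤ ∑ˡ f xs
∈⇒≤∑ˡ f {xs = _ ∷ xs} (here refl) = m≤m+n _ (∑ˡ f xs)
∈⇒≤∑ˡ f {xs = y ∷ xs} (there x∈)  = ≤-trans (∈⇒≤∑ˡ f x∈) (m≤n+m (∑ˡ f xs) (f y))

∑-exclusive : ∀ {ℓ} {Q : ℕ → Set ℓ} (Q? : ∀ i → Dec (Q i)) n → (∀ {i j} → i < j → j < n → Q i → Q j → ⊥) →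
              ∑ n (λ i → ⟦ Q? i ⟧) ≤ 1
∑-exclusive Q? zero    excl = z≤n
∑-exclusive Q? (suc n) excl with Q? n
... | no  _ = subst (_≤ 1) (sym (+-identityʳ _)) (∑-exclusive Q? n (λ i<j j<n → excl i<j (m<n⇒m<1+n j<n)))
... | yes q = ≤-reflexive (cong (_+ 1) (trans (∑-cong n (λ i i<n → ⟦⟧-false (Q? i) (λ p → excl i<n ≤-refl p q))) (trans (∑-const n 0) (*-zeroʳ n))))

-- Units in an arithmetic progression

prime-∤1 : ∀ {p} → Prime p → ¬ p ∣ 1
prime-∤1 pr p∣1 with ∣1⇒≡1 p∣1
... | refl = ¬prime[1] pr

prime∣prime : ∀ {p q} → Prime p → Prime q → p ∣ q → p ≡ q
prime∣prime pr-p pr-q p∣q with prime⇒irreducible pr-q p∣q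
... | inj₁ refl = ⊥-elim (¬prime[1] pr-p)
... | inj₂ eq   = eq

prime∣!⇒≤ : ∀ {p} m → Prime p → p ∣ m ! → p ≤ m
prime∣!⇒≤ zero    pr p∣ = ⊥-elim (prime-∤1 pr p∣)
prime∣!⇒≤ (suc m) pr p∣ = [ ∣⇒≤ , m≤n⇒m≤1+n ∘ prime∣!⇒≤ m pr ]′ (euclidsLemma (suc m) (m !) pr p∣)

n∣n! : ∀ n .{{_ : NonZero n}} → n ∣ n !
n∣n! (suc n) = m∣m*n (n !)

∣! : ∀ {m n} .{{_ : NonZero m}} → m ≤ n → m ∣ n !
∣! {m} m≤n = ∣-trans (n∣n! m) (m≤n⇒m!∣n! m≤n)

-- Chebyshev's upper bound for products of primes

primeOr1 : ℕ → ℕ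
primeOr1 x with prime? x
... | yes _ = x
... | no  _ = 1

-- The primes range over the half-open interval `(m, m + n]`, so that dyadic intervals tile.
∏primes : ℕ → ℕ → ℕ
∏primes m zero    = 1
∏primes m (suc n) = ∏primes m n * primeOr1 (m + suc n)

prime∣primeOr1 : ∀ {p} x → Prime p → p ∣ primeOr1 x → p ≡ x
prime∣primeOr1 x pr p∣ with prime? x
... | yes pr-x = prime∣prime pr pr-x p∣
... | no  _    = ⊥-elim (prime-∤1 pr p∣)

primeOr1-prime : ∀ {p} → Prime p → primeOr1 p ≡ p
primeOr1-prime {p} pr with prime? p
... | yes _  = refl
... | no ¬pr = ⊥-elim (¬pr pr)

∏primes-≤ : ∀ {p} m n → Prime p → p ∣ ∏primes m n → p ≤ m + n
∏primes-≤ m zero    pr p∣ = ⊥-elim (prime-∤1 pr p∣)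
∏primes-≤ m (suc n) pr p∣ =
  [ (λ q → ≤-trans (∏primes-≤ m n pr q) (+-monoʳ-≤ m (n≤1+n n))) , (λ q → ≤-reflexive (prime∣primeOr1 (m + suc n) pr q)) ]′
    (euclidsLemma (∏primes m n) (primeOr1 (m + suc n)) pr p∣)

∣∏primes : ∀ {p} m n → Prime p → m < p → p ≤ m + n → p ∣ ∏primes m n
∣∏primes m zero    pr m<p p≤ = ⊥-elim (<⇒≱ m<p (subst (_ ≤_) (+-identityʳ m) p≤))
∣∏primes {p} m (suc n) pr m<p p≤ with p ≟ m + suc n
... | yes refl = ∣n⇒∣m*n (∏primes m n) (∣-reflexive (sym (primeOr1-prime pr)))
... | no neq   = ∣m⇒∣m*n (primeOr1 (m + suc n)) (∣∏primes m n pr m<p (s≤s⁻¹ (subst (p <_) (+-suc m n) (≤∧≢⇒< p≤ neq))))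

∏primes-∣ : ∀ {b} m n → (∀ {p} → Prime p → m < p → p ≤ m + n → p ∣ b) → ∏primes m n ∣ b
∏primes-∣ {b} m zero    div = 1∣ b
∏primes-∣ {b} m (suc n) div with ∏primes-∣ m n (λ pr m<p p≤ → div pr m<p (≤-trans p≤ (+-monoʳ-≤ m (n≤1+n n)))) | prime? (m + suc n)
... | IH | no _ = subst (_∣ b) (sym (*-identityʳ _)) IH
... | divides c refl | yes pr = subst (_∣ c * ∏primes m n) (*-comm x (∏primes m n)) (*-monoˡ-∣ (∏primes m n) x∣c)
  where
  x = m + suc n
  -- `x` exceeds every prime factor of `∏primes m n`, so Euclid's lemma places it in the cofactor.
  x∣c : x ∣ c
  x∣c = [ (λ p → p) , (λ p → ⊥-elim (<⇒≱ (+-monoʳ-< m (n<1+n n)) (∏primes-≤ m n pr p))) ]′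
          (euclidsLemma c (∏primes m n) pr (div pr (m<m+n m z<s) ≤-refl))

central-binomial : ∀ m → ∃[ b ] (m + m) ! ≡ b * (m ! * m !)
central-binomial m with k![n∸k]!∣n! {m + m} {m} (m≤m+n m m)
... | divides b eq = b , trans eq (cong (λ k → b * (m ! * k !)) (m+n∸n≡m m m))

-- Successive central binomial coefficients satisfy `(m + 1) b′ = 2 (2 m + 1) b`, so each is less
-- than 4 times the previous one.
central-binomial-≤ : ∀ m {b} → (m + m) ! ≡ b * (m ! * m !) → b ≤ 4 ^ m
central-binomial-≤ zero    {b} eq = ≤-reflexive (sym (trans eq (*-identityʳ b)))
central-binomial-≤ (suc m) {b′} eq with central-binomial m
... | b , eq₀ = ≤-trans (*-cancelʳ-≤ b′ (4 * b) (suc m) (≤-trans (≤-reflexive recurrence) bound)) (*-monoʳ-≤ 4 (central-binomial-≤ m {b} eq₀))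
  where
  f = m !
  instance
    f≢0 : NonZero (suc m * (f * f))
    f≢0 = m*n≢0 (suc m) (f * f) {{_}} {{m*n≢0 f f {{m !≢0}} {{m !≢0}}}}
  lemma₁ : ∀ m b f → 2 * (1 + (m + m)) * b * ((1 + m) * (f * f)) ≡ (1 + (1 + (m + m))) * ((1 + (m + m)) * (b * (f * f)))
  lemma₁ = solve-∀
  lemma₂ : ∀ m b f → b * ((1 + m) * f * ((1 + m) * f)) ≡ b * (1 + m) * ((1 + m) * (f * f))
  lemma₂ = solve-∀
  recurrence : b′ * suc m ≡ 2 * (1 + (m + m)) * b
  recurrence = *-cancelʳ-≡ _ _ (suc m * (f * f)) (sym (begin
    2 * (1 + (m + m)) * b * (suc m * (f * f))                        ≡⟨ lemma₁ m b f ⟩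
    suc (suc (m + m)) * (suc (m + m) * (b * (f * f)))                ≡⟨ cong (λ z → suc (suc (m + m)) * (suc (m + m) * z)) eq₀ ⟨
    suc (suc (m + m)) !                                              ≡⟨ cong (λ z → suc z !) (+-suc m m) ⟨
    (suc m + suc m) !                                                ≡⟨ eq ⟩
    b′ * (suc m * f * (suc m * f))                                   ≡⟨ lemma₂ m b′ f ⟩
    b′ * suc m * (suc m * (f * f))                                   ∎))
    where open ≡-Reasoning
  bound : 2 * (1 + (m + m)) * b ≤ 4 * b * suc m
  bound = linear (2 * b) (z≤n {0}) (lemma₃ m b)
    where
    lemma₃ : ∀ m b → 2 * (1 + (m + m)) * b + 0 + 2 * b ≡ 4 * b * (1 + m) + 0
    lemma₃ = solve-∀

-- A prime in `(m, 2m]` divides `(m + m) !` but not `m !`, hence it divides the central binomial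
-- coefficient.
∏primes-≤-4^ : ∀ m → ∏primes m m ≤ 4 ^ m
∏primes-≤-4^ m with central-binomial m
... | b , eq = ≤-trans (∣⇒≤ {{≢-nonZero b≢0}} (∏primes-∣ m m divide)) (central-binomial-≤ m eq)
  where
  b≢0 : b ≢ 0
  b≢0 refl = ≢-nonZero⁻¹ ((m + m) !) {{(m + m) !≢0}} eq
  divide : ∀ {p} → Prime p → m < p → p ≤ m + m → p ∣ b
  divide pr m<p p≤ with euclidsLemma b (m ! * m !) pr (subst (_ ∣_) eq (∣! {{prime⇒nonZero pr}} p≤))
  ... | inj₁ p∣b = p∣b
  ... | inj₂ p∣m!m! = ⊥-elim (<⇒≱ m<p ([ prime∣!⇒≤ m pr , prime∣!⇒≤ m pr ]′ (euclidsLemma (m !) (m !) pr p∣m!m!)))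

-- The product of all primes up to `2 ^ J`, in dyadic blocks: the bounds `4 ^ 2 ^ i` for `i < J`
-- multiply to less than `4 ^ 2 ^ J`.
primorial-2^ : ℕ → ℕ
primorial-2^ zero    = 1
primorial-2^ (suc J) = primorial-2^ J * ∏primes (2 ^ J) (2 ^ J)

2^suc : ∀ J → 2 ^ suc J ≡ 2 ^ J + 2 ^ J
2^suc J = cong (2 ^ J +_) (+-identityʳ (2 ^ J))

primorial-2^-≤ : ∀ J → primorial-2^ J ≤ 4 ^ 2 ^ J
primorial-2^-≤ zero    = s≤s z≤n
primorial-2^-≤ (suc J) = begin
  primorial-2^ J * ∏primes (2 ^ J) (2 ^ J)     ≤⟨ *-mono-≤ (primorial-2^-≤ J) (∏primes-≤-4^ (2 ^ J)) ⟩
  4 ^ 2 ^ J * 4 ^ 2 ^ J                      ≡⟨ ^-distribˡ-+-* 4 (2 ^ J) (2 ^ J) ⟨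
  4 ^ (2 ^ J + 2 ^ J)                        ≡⟨ cong (4 ^_) (2^suc J) ⟨
  4 ^ 2 ^ suc J                              ∎
  where open ≤-Reasoning

∣primorial-2^ : ∀ {p} J → Prime p → p ≤ 2 ^ J → p ∣ primorial-2^ J
∣primorial-2^ zero    pr p≤1 = ⊥-elim (<⇒≱ (nonTrivial⇒n>1 _ {{prime⇒nonTrivial pr}}) p≤1)
∣primorial-2^ {p} (suc J) pr p≤ with p ≤? 2 ^ J
... | yes p≤y = ∣m⇒∣m*n _ (∣primorial-2^ J pr p≤y)
... | no  p≰y = ∣n⇒∣m*n (primorial-2^ J) (∣∏primes (2 ^ J) (2 ^ J) pr (≰⇒> p≰y) (subst (p ≤_) (2^suc J) p≤))

primeOr1-nonZero : ∀ x → NonZero (primeOr1 x)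
primeOr1-nonZero x with prime? x
... | yes pr = prime⇒nonZero pr
... | no  _  = _

∏primes-nonZero : ∀ m n → NonZero (∏primes m n)
∏primes-nonZero m zero    = _
∏primes-nonZero m (suc n) = m*n≢0 _ _ {{∏primes-nonZero m n}} {{primeOr1-nonZero (m + suc n)}}

primorial-2^-nonZero : ∀ J → NonZero (primorial-2^ J)
primorial-2^-nonZero zero    = _
primorial-2^-nonZero (suc J) = m*n≢0 _ _ {{primorial-2^-nonZero J}} {{∏primes-nonZero (2 ^ J) (2 ^ J)}}

-- Prime factors above y and the non-units they cause

LargePrimes : ℕ → ℕ → List ℕ → Set
LargePrimes d y ps = (∀ {p} → p ∈ ps → Prime p × y < p) × y ^ length ps ≤ d × (∀ {p} → Prime p → p ∣ d → y < p → p ∈ ps)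

-- The list keeps multiplicities, so its product divides `d`; repetitions only enlarge the union
-- bound taken over it later.
large-primes : ∀ d .{{_ : NonZero d}} y → ∃[ ps ] LargePrimes d y ps
large-primes d y = filter (y <?_) factors
  , (λ p∈ → let (p∈fs , y<p) = ∈-filter⁻ (y <?_) p∈ in All.lookup factorsPrime p∈fs , y<p)
  , subst (y ^ length (filter (y <?_) factors) ≤_) (sym isFactorisation) (power-bound factorsPrime)
  , (λ {p} pr p∣d y<p → ∈-filter⁺ (y <?_) (factorisationHasAllPrimeFactors pr (subst (p ∣_) isFactorisation p∣d) factorsPrime) y<p)
  where
  open PrimeFactorisation (factorise d)
  power-bound : ∀ {fs} → All Prime fs → y ^ length (filter (y <?_) fs) ≤ product fs
  power-bound [] = ≤-refl
  power-bound {f ∷ fs} (pr ∷ prs) with y <? f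
  ... | yes y<f rewrite filter-accept (y <?_) {f} {fs} y<f = *-mono-≤ (<⇒≤ y<f) (power-bound prs)
  ... | no  y≮f rewrite filter-reject (y <?_) {f} {fs} y≮f = ≤-trans (power-bound prs) (m≤n*m (product fs) f {{prime⇒nonZero pr}})

∃prime∣ : ∀ n .{{_ : NonZero n}} → n ≢ 1 → ∃[ p ] (Prime p × p ∣ n)
∃prime∣ n n≢1 with factorise n
... | record { factors = [] ; isFactorisation = eq } = ⊥-elim (n≢1 eq)
... | record { factors = p ∷ ps ; isFactorisation = refl ; factorsPrime = pr ∷ _ } = p , pr , m∣m*n (product ps)

noncoprime : ℕ → ℕ → ℕ → ℕ
noncoprime d P k = ⟦ ¬? (coprime? (1 + k * P) d) ⟧

∤-shared : ∀ {p P} k → Prime p → p ∣ 1 + k * P → ¬ p ∣ P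
∤-shared {p} {P} k pr p∣u p∣P = prime-∤1 pr (∣m+n∣m⇒∣n (subst (p ∣_) (+-comm 1 (k * P)) p∣u) (∣n⇒∣m*n k p∣P))

-- Two multiples of `p` would differ by `(j − i) * P` with `0 < j − i < p`, and a divisor `p` of
-- `1 + k * P` cannot divide `P`.
∣-sparse : ∀ {p y P} b → Prime p → y < p → ∑ y (λ i → ⟦ p ∣? 1 + (b + i) * P ⟧) ≤ 1
∣-sparse {p} {y} {P} b pr y<p = ∑-exclusive (λ i → p ∣? 1 + (b + i) * P) y excl
  where
  lemma : ∀ b i e P → 1 + (b + (i + e)) * P ≡ 1 + (b + i) * P + e * P
  lemma = solve-∀
  excl : ∀ {i j} → i < j → j < y → p ∣ 1 + (b + i) * P → p ∣ 1 + (b + j) * P → ⊥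
  excl {i} {j} i<j j<y p∣i p∣j with euclidsLemma (j ∸ i) P pr (∣m+n∣m⇒∣n (subst (p ∣_)
      (trans (cong (λ z → 1 + (b + z) * P) (sym (m+[n∸m]≡n (<⇒≤ i<j)))) (lemma b i (j ∸ i) P)) p∣j) p∣i)
  ... | inj₁ p∣e = >⇒∤ {{>-nonZero (m<n⇒0<n∸m i<j)}} (≤-<-trans (m∸n≤m j i) (<-trans j<y y<p)) p∣e
  ... | inj₂ p∣P = ∤-shared (b + i) pr p∣i p∣P

module _ {d y P : ℕ} .{{_ : NonZero d}} {ps : List ℕ} (large : LargePrimes d y ps)
         (small∣P : ∀ {p} → Prime p → p ≤ y → p ∣ P) where

  -- A prime common to `1 + k * P` and `d` exceeds `y`, as otherwise it would divide `P`; so it is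
  -- in `ps`.
  noncoprime-≤ : ∀ k → noncoprime d P k ≤ ∑ˡ (λ p → ⟦ p ∣? 1 + k * P ⟧) ps
  noncoprime-≤ k with coprime? (1 + k * P) d
  ... | yes cop = ≤-trans (≤-reflexive (⟦⟧-false (¬? (coprime? (1 + k * P) d)) (λ ¬cop → ¬cop cop))) z≤n
  ... | no ¬cop with any? (λ p → p ∣? 1 + k * P) ps
  ...   | yes some = let (p , p∈ , p∣u) = find some in
            ≤-trans (⟦⟧≤1 (¬? (coprime? (1 + k * P) d)))
              (≤-trans (≤-reflexive (sym (⟦⟧-true (p ∣? 1 + k * P) p∣u))) (∈⇒≤∑ˡ (λ p → ⟦ p ∣? 1 + k * P ⟧) p∈))
  ...   | no none = ⊥-elim (¬cop coprime)
    where
    coprime : Coprime (1 + k * P) d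
    coprime {i} (i∣u , i∣d) with i ≟ 1
    ... | yes i≡1 = i≡1
    ... | no  i≢1 with ∃prime∣ i {{≢-nonZero λ { refl → ≢-nonZero⁻¹ d (0∣⇒≡0 i∣d) }}} i≢1
    ...   | p , pr , p∣i with p ≤? y
    ...     | yes p≤y = ⊥-elim (∤-shared k pr (∣-trans p∣i i∣u) (small∣P pr p≤y))
    ...     | no  p≰y = ⊥-elim (none (lose (proj₂ (proj₂ large) pr (∣-trans p∣i i∣d) (≰⇒> p≰y)) (∣-trans p∣i i∣u)))

  -- `K` counts blocks of `y` consecutive members, so the density of non-units is at most
  -- `length ps / y`.
  noncoprime-count : ∀ a K → ∑ (K * y) (λ k → noncoprime d P (a + k)) ≤ length ps * K
  noncoprime-count a K = begin
    ∑ (K * y) (λ k → noncoprime d P (a + k))                                      ≤⟨ ∑-mono (K * y) (λ k _ → noncoprime-≤ (a + k)) ⟩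
    ∑ (K * y) (λ k → ∑ˡ (λ p → ⟦ p ∣? 1 + (a + k) * P ⟧) ps)                  ≡⟨ ∑-∑ˡ-swap (K * y) (λ k p → ⟦ p ∣? 1 + (a + k) * P ⟧) ps ⟩
    ∑ˡ (λ p → ∑ (K * y) (λ k → ⟦ p ∣? 1 + (a + k) * P ⟧)) ps                  ≤⟨ ∑ˡ-bound {xs = ps} (λ p∈ → multiples-count p∈) ⟩
    length ps * K                                                             ∎
    where
    open ≤-Reasoning
    multiples-count : ∀ {p} → p ∈ ps → ∑ (K * y) (λ k → ⟦ p ∣? 1 + (a + k) * P ⟧) ≤ K
    multiples-count {p} p∈ = begin
      ∑ (K * y) (λ k → ⟦ p ∣? 1 + (a + k) * P ⟧)                              ≡⟨ ∑-blocks K y _ ⟩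
      ∑ K (λ k → ∑ y (λ i → ⟦ p ∣? 1 + (a + (k * y + i)) * P ⟧))              ≤⟨ ∑-mono K (λ k _ → block k) ⟩
      ∑ K (λ _ → 1)                                                           ≡⟨ trans (∑-const K 1) (*-identityʳ K) ⟩
      K                                                                       ∎
      where
      block : ∀ k → ∑ y (λ i → ⟦ p ∣? 1 + (a + (k * y + i)) * P ⟧) ≤ 1
      block k = let (pr , y<p) = proj₁ large p∈ in
        subst (_≤ 1) (∑-cong y (λ i _ → cong (λ z → ⟦ p ∣? 1 + z * P ⟧) (+-assoc a (k * y) i))) (∣-sparse (a + k * y) pr y<p)

-- Comparison and counting for list sums

∑ˡ-mono : ∀ {a} {A : Set a} {f g : A → ℕ} {c} xs → (∀ {x} → x ∈ xs → f x ≤ g x + c) → ∑ˡ f xs ≤ ∑ˡ g xs + length xs * c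
∑ˡ-mono []       le = z≤n
∑ˡ-mono {f = f} {g} {c} (x ∷ xs) le = linear 0 (+-mono-≤ (le (here refl)) (∑ˡ-mono {f = f} {g} xs (le ∘ there)))
    (lemma (f x) (∑ˡ f xs) (g x) (∑ˡ g xs) c (length xs * c))
  where
  lemma : ∀ a b a′ b′ c e → a + b + (a′ + c + (b′ + e)) + 0 ≡ a′ + b′ + (c + e) + (a + b)
  lemma = solve-∀

∑ˡ-mono-gap : ∀ {a} {A : Set a} {f g : A → ℕ} {c e x₀ xs} → x₀ ∈ xs → f x₀ + e ≤ g x₀ + c →
              (∀ {x} → x ∈ xs → f x ≤ g x + c) → ∑ˡ f xs + e ≤ ∑ˡ g xs + length xs * c
∑ˡ-mono-gap {f = f} {g} {c} {e} {x₀} {_ ∷ xs} (here refl) gap le =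
  linear 0 (+-mono-≤ gap (∑ˡ-mono {f = f} {g} {c} xs (le ∘ there))) (lemma (f x₀) (∑ˡ f xs) (g x₀) (∑ˡ g xs) c (length xs * c) e)
  where
  lemma : ∀ a b a′ b′ c l e → a + b + e + (a′ + c + (b′ + l)) + 0 ≡ a′ + b′ + (c + l) + (a + e + b)
  lemma = solve-∀
∑ˡ-mono-gap {f = f} {g} {c} {e} {x₀} {x ∷ xs} (there x₀∈) gap le =
  linear 0 (+-mono-≤ (le (here refl)) (∑ˡ-mono-gap {f = f} {g} {c} {e} x₀∈ gap (le ∘ there))) (lemma (f x) (∑ˡ f xs) (g x) (∑ˡ g xs) c (length xs * c) e)
  where
  lemma : ∀ a b a′ b′ c l e → a + b + e + (a′ + c + (b′ + l)) + 0 ≡ a′ + b′ + (c + l) + (a + (b + e))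
  lemma = solve-∀

∑ˡ-* : ∀ {a} {A : Set a} c (f : A → ℕ) xs → ∑ˡ (λ x → c * f x) xs ≡ c * ∑ˡ f xs
∑ˡ-* c f []       = sym (*-zeroʳ c)
∑ˡ-* c f (x ∷ xs) = trans (cong (c * f x +_) (∑ˡ-* c f xs)) (sym (*-distribˡ-+ c (f x) (∑ˡ f xs)))

length-filter-∑ˡ : ∀ {a p} {A : Set a} {Q : A → Set p} (Q? : Decidable Q) xs → length (filter Q? xs) ≡ ∑ˡ (λ x → ⟦ Q? x ⟧) xs
length-filter-∑ˡ Q? []       = refl
length-filter-∑ˡ Q? (x ∷ xs) with Q? x
... | yes _ = cong suc (length-filter-∑ˡ Q? xs)
... | no  _ = length-filter-∑ˡ Q? xs

length-filter-¬ : ∀ {a p} {A : Set a} {Q : A → Set p} (Q? : Decidable Q) xs →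
                  length (filter Q? xs) + length (filter (λ x → ¬? (Q? x)) xs) ≡ length xs
length-filter-¬ Q? []       = refl
length-filter-¬ Q? (x ∷ xs) with Q? x
... | yes _ = cong suc (length-filter-¬ Q? xs)
... | no  _ = trans (+-suc _ _) (cong suc (length-filter-¬ Q? xs))

-- Comparing the two sides of d/2

module _ {d : ℕ} .{{_ : NonZero d}} where
  open Low d
  open Congruence d

  countA-coset : ∀ u H → countA d (coset d u H) ≡ ∑ˡ (λ h → low (u * h)) H
  countA-coset u H = trans (length-filter-∑ˡ (λ r → 2 * r <? d) (coset d u H)) (cong sum (sym (map-∘ H)))

  balanced-∑ˡ : ∀ {H} → Balanced d H → ∀ {u v} → IsUnit d u → IsUnit d v → ∑ˡ (λ h → low (u * h)) H ≡ ∑ˡ (λ h → low (v * h)) H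
  balanced-∑ˡ {H} bal {u} {v} unit-u unit-v = *-cancelˡ-≡ _ _ 2 (trans (half u unit-u) (sym (half v unit-v)))
    where
    half : ∀ u → IsUnit d u → 2 * ∑ˡ (λ h → low (u * h)) H ≡ length H
    half u unit-u = begin
      2 * ∑ˡ (λ h → low (u * h)) H                            ≡⟨ cong (2 *_) (countA-coset u H) ⟨
      2 * countA d (coset d u H)                              ≡⟨ cong (countA d (coset d u H) +_) (trans (+-identityʳ _) (bal u unit-u)) ⟩
      countA d (coset d u H) + countB d (coset d u H)         ≡⟨ length-filter-¬ (λ r → 2 * r <? d) (coset d u H) ⟩
      length (coset d u H)                                    ≡⟨ length-map (mulMod d u) H ⟩
      length H                                                ∎
      where open ≡-Reasoning

  module Core
    {H : List ℕ} (sub : IsSubgroup d H) (bal : Balanced d H) (2<d : 2 < d)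
    (-1∉H : ¬ (d ∸ 1) ∈ H) (1+d/2∉H : ¬ ((4 ∣ d) × (d / 2 + 1) ∈ H))
    {P C K R : ℕ} .{{_ : NonZero P}} .{{_ : NonZero C}} .{{_ : NonZero R}}
    -- 28 is 4 times 7: the equidistribution errors, `7 * K` for each element, add up to a quarter
    -- of the gap `C * K`.
    (C-large : C ≡ 28 * length H)
    (divides-K : ∀ {q} → 1 ≤ q → q ≤ C → q ∣ K)
    -- Keeps `2 * (e * s) < d` for every `e = q * P` with `q ≤ C`, as `low-shift` demands.
    (short : 2 * (C * P * (K * P)) < d)
    -- An index class mod `q ≤ C` has `K / q` members; with steps `r ≥ R` it covers at least
    -- `C * d`.
    (travel : C * (C * d) ≤ K * R)
    (CP≤R : C * P ≤ R)
    (R²ⁿ<d : (R * R) ^ length H < d)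
    where

    open IsSubgroup sub

    private
      n = length H
      s = K * P
      -- The last index `k` with `2 * (1 + k * P) < d`, a condition that reads
      -- `k * (2 * P) ≤ d − 3`.
      c₀ = (d ∸ 3) / (2 * P)
      instance
        2P≢0 : NonZero (2 * P)
        2P≢0 = m*n≢0 2 P

    2s<d : 2 * s < d
    2s<d = ≤-<-trans (*-monoʳ-≤ 2 (m≤n*m s (C * P) {{m*n≢0 C P}})) short

    c₀-lower : 3 + c₀ * (2 * P) ≤ d
    c₀-lower = ≤-trans (+-monoʳ-≤ 3 (m/n*n≤m (d ∸ 3) (2 * P))) (≤-reflexive (m+[n∸m]≡n 2<d))

    c₀-upper : d ≤ 2 * (1 + (1 + c₀) * P)
    c₀-upper = begin
      d                                                  ≡⟨ m+[n∸m]≡n 2<d ⟨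
      3 + (d ∸ 3)                                        ≡⟨ cong (3 +_) (m≡m%n+[m/n]*n (d ∸ 3) (2 * P)) ⟩
      3 + ((d ∸ 3) % (2 * P) + c₀ * (2 * P))             ≤⟨ linear 0 (m%n<n (d ∸ 3) (2 * P)) (lemma ((d ∸ 3) % (2 * P)) c₀ P) ⟩
      2 * (1 + (1 + c₀) * P)                             ∎
      where
      open ≤-Reasoning
      lemma : ∀ r c P → 3 + (r + c * (2 * P)) + 2 * P + 0 ≡ 2 * (1 + (1 + c) * P) + (1 + r)
      lemma = solve-∀

    K≤c : K ≤ 1 + c₀
    K≤c = ≮⇒≥ λ c<K → <⇒≱ 2s<d (≤-trans c₀-upper (linear 0
            (+-mono-≤ (*-monoˡ-≤ (2 * P) c<K) (*-monoʳ-≤ 2 (>-nonZero⁻¹ P))) (lemma c₀ P K)))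
      where
      lemma : ∀ c P K → 2 * (1 + (1 + c) * P) + (K * (2 * P) + 2 * P) + 0 ≡ 2 * (K * P) + ((2 + c) * (2 * P) + 2 * 1)
      lemma = solve-∀

    -- `u` takes the last `K` indices `a, …, c₀` below d/2 and `v` the next `K`; `K≤c` makes the
    -- subtraction exact.
    a = 1 + c₀ ∸ K

    u v : ℕ → ℕ
    u k = 1 + (a + k) * P
    v k = 1 + (a + (K + k)) * P

    v≡u+s : ∀ k → v k ≡ u k + s
    v≡u+s k = lemma a K k P
      where
      lemma : ∀ a K k P → 1 + (a + (K + k)) * P ≡ 1 + (a + k) * P + K * P
      lemma = solve-∀

    a+K : a + K ≡ 1 + c₀
    a+K = m∸n+n≡m K≤c

    2u<d : ∀ k → k < K → 2 * u k < d
    2u<d k k<K = ≤-trans (linear 0 (*-monoˡ-≤ (2 * P) a+k≤c₀) (lemma (a + k) P c₀)) c₀-lower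
      where
      a+k≤c₀ : a + k ≤ c₀
      a+k≤c₀ = s≤s⁻¹ (subst (suc (a + k) ≤_) a+K (+-monoʳ-< a k<K))
      lemma : ∀ m P c → 1 + 2 * (1 + m * P) + c * (2 * P) + 0 ≡ 3 + c * (2 * P) + m * (2 * P)
      lemma = solve-∀

    d≤2v : ∀ k → d ≤ 2 * v k
    d≤2v k = ≤-trans c₀-upper (*-monoʳ-≤ 2 (s≤s (*-monoˡ-≤ P
      (subst (_≤ a + (K + k)) a+K (+-monoʳ-≤ a (m≤m+n K k))))))

    u<d : ∀ k → k < K → u k < d
    u<d k k<K = ≤-<-trans (m≤n*m (u k) 2) (2u<d k k<K)

    v<d : ∀ k → k < K → v k < d
    v<d k k<K = *-cancelˡ-< 2 (v k) d (subst₂ _<_ (trans (sym (*-distribˡ-+ 2 (u k) s)) (cong (2 *_) (sym (v≡u+s k))))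
                  (cong (d +_) (sym (+-identityʳ d))) (+-mono-< (2u<d k k<K) 2s<d))

    -- With the weight `good`, the balance equation can be summed over all `k`: it reads 0 = 0
    -- unless both members are units. `bad` is the price of restoring the weight.
    good bad : ℕ → ℕ
    good k = ⟦ coprime? (u k) d ⟧ * ⟦ coprime? (v k) d ⟧
    bad k = ⟦ ¬? (coprime? (u k) d) ⟧ + ⟦ ¬? (coprime? (v k) d) ⟧

    U V : ℕ → ℕ
    U h = ∑ K (λ k → good k * low (u k * h))
    V h = ∑ K (λ k → good k * low (v k * h))

    #bad : ℕ
    #bad = ∑ K bad

    data Quality (k : ℕ) : Set where
      both    : Coprime (u k) d → Coprime (v k) d → good k ≡ 1 → Quality k
      neither : good k ≡ 0 → 1 ≤ bad k → Quality k

    quality : ∀ k → Quality k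
    quality k with coprime? (u k) d | coprime? (v k) d
    ... | yes cu | yes cv = both cu cv (cong₂ _*_ (⟦⟧-true (coprime? (u k) d) cu) (⟦⟧-true (coprime? (v k) d) cv))
    ... | no ¬cu | _      = neither (cong (_* ⟦ coprime? (v k) d ⟧) (⟦⟧-false (coprime? (u k) d) ¬cu))
                              (≤-trans (≤-reflexive (sym (⟦⟧-true (¬? (coprime? (u k) d)) ¬cu))) (m≤m+n _ _))
    ... | yes _  | no ¬cv = neither (trans (cong (⟦ coprime? (u k) d ⟧ *_) (⟦⟧-false (coprime? (v k) d) ¬cv)) (*-zeroʳ ⟦ coprime? (u k) d ⟧))
                              (≤-trans (≤-reflexive (sym (⟦⟧-true (¬? (coprime? (v k) d)) ¬cv))) (m≤n+m _ _))

    good-≤ : ∀ k {x} → good k * x ≤ x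
    good-≤ k {x} with quality k
    ... | both _ _ eq  rewrite eq = ≤-reflexive (+-identityʳ x)
    ... | neither eq _ rewrite eq = z≤n

    ≤-good+bad : ∀ k {x} → x ≤ 1 → x ≤ good k * x + bad k
    ≤-good+bad k {x} x≤1 with quality k
    ... | both _ _ eq    rewrite eq = ≤-trans (≤-reflexive (sym (+-identityʳ x))) (m≤m+n (x + 0) (bad k))
    ... | neither eq b rewrite eq = ≤-trans x≤1 b

    ∑ˡU≡∑ˡV : ∑ˡ V H ≡ ∑ˡ U H
    ∑ˡU≡∑ˡV = trans (sym (∑-∑ˡ-swap K (λ k h → good k * low (v k * h)) H))
              (trans (∑-cong K pointwise) (∑-∑ˡ-swap K (λ k h → good k * low (u k * h)) H))
      where
      pointwise : ∀ k → k < K → ∑ˡ (λ h → good k * low (v k * h)) H ≡ ∑ˡ (λ h → good k * low (u k * h)) H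
      pointwise k k<K = trans (∑ˡ-* (good k) (λ h → low (v k * h)) H) (trans balance (sym (∑ˡ-* (good k) (λ h → low (u k * h)) H)))
        where
        balance : good k * ∑ˡ (λ h → low (v k * h)) H ≡ good k * ∑ˡ (λ h → low (u k * h)) H
        balance with quality k
        ... | both cu cv _ = cong (good k *_) (balanced-∑ˡ {H} bal (v<d k k<K , cv) (u<d k k<K , cu))
        ... | neither eq _ rewrite eq = refl

    -- At the identity every `v k` counts 0 and every `u k` counts 1, so `U` misses `K` by the bad
    -- pairs only.
    identity-gap : C * V (1 % d) + C * K ≤ C * U (1 % d) + C * #bad
    identity-gap = begin
      C * V 1′ + C * K                   ≡⟨ cong (λ z → C * z + C * K) V1≡0 ⟩
      C * 0 + C * K                      ≡⟨ cong (_+ C * K) (*-zeroʳ C) ⟩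
      C * K                              ≤⟨ *-monoʳ-≤ C K≤ ⟩
      C * (U 1′ + #bad)                  ≡⟨ *-distribˡ-+ C (U 1′) #bad ⟩
      C * U 1′ + C * #bad                ∎
      where
      open ≤-Reasoning
      1′ = 1 % d
      times-1 : ∀ {x} → x < d → (x * 1′) % d ≡ x
      times-1 {x} x<d = trans (*-congˡ-≈ x {1′} {1} (%-≈ 1)) (trans (cong (_% d) (*-identityʳ x)) (m<n⇒m%n≡m x<d))
      V1≡0 : V 1′ ≡ 0
      V1≡0 = trans (∑-cong K (λ k k<K → trans (cong (good k *_) (⟦⟧-false (2 * (v k * 1′ % d) <? d)
                 (≤⇒≯ (subst (λ z → d ≤ 2 * z) (sym (times-1 (v<d k k<K))) (d≤2v k))))) (*-zeroʳ (good k))))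
               (trans (∑-const K 0) (*-zeroʳ K))
      K≤ : K ≤ U 1′ + #bad
      K≤ = begin
        K                                                        ≡⟨ trans (∑-const K 1) (*-identityʳ K) ⟨
        ∑ K (λ _ → 1)                                            ≤⟨ ∑-mono K (λ k k<K → subst (λ z → 1 ≤ good k * z + bad k)
                                                                      (sym (⟦⟧-true (2 * (u k * 1′ % d) <? d)
                                                                        (subst (λ z → 2 * z < d) (sym (times-1 (u<d k k<K))) (2u<d k k<K))))
                                                                      (≤-good+bad k {1} ≤-refl)) ⟩
        ∑ K (λ k → good k * low (u k * 1′) + bad k)              ≡⟨ ∑-+ K (λ k → good k * low (u k * 1′)) bad ⟩
        U 1′ + #bad                                              ∎

    error : ℕ
    error = 7 * K + C * #bad

    -- Dropping the weight enlarges the left side, and restoring it on the right costs `#bad`; in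
    -- between, both unweighted progressions have step `P * h` and are equidistributed.
    generic-element : ∀ {h q r} .{{_ : NonZero q}} .{{_ : NonZero r}} → q ≤ C → q ∣ K → C * r ≤ d → R ≤ r → q * (P * h) ≈± r →
                      C * V h ≤ C * U h + error
    generic-element {h} {q} {r} q≤C (divides K′ K≡) Cr≤d R≤r rel = begin
      C * V h                                                        ≤⟨ *-monoʳ-≤ C (∑-mono K (λ k _ → good-≤ k)) ⟩
      C * ∑ K (λ k → low (v k * h))                                  ≡⟨ cong (C *_) (along (a + K) (λ k → cong (λ z → (1 + z * P) * h) (sym (+-assoc a K k)))) ⟩
      C * ∑ (K′ * q) (λ k → low (base (a + K) + k * (P * h)))       ≤⟨ progression-equidistribution rel K′ C Cr≤d travel′ (base a) (base (a + K)) ⟩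
      C * ∑ (K′ * q) (λ k → low (base a + k * (P * h))) + 7 * (K′ * q)   ≡⟨ cong₂ (λ x y → C * x + 7 * y) (along a (λ _ → refl)) K≡ ⟨
      C * ∑ K (λ k → low (u k * h)) + 7 * K                          ≤⟨ +-monoˡ-≤ (7 * K) (*-monoʳ-≤ C (∑-mono K (λ k _ → ≤-good+bad k (low≤1 (u k * h))))) ⟩
      C * ∑ K (λ k → good k * low (u k * h) + bad k) + 7 * K         ≡⟨ cong (λ z → C * z + 7 * K) (∑-+ K (λ k → good k * low (u k * h)) bad) ⟩
      C * (U h + #bad) + 7 * K                                       ≡⟨ lemma C (U h) #bad K ⟩
      C * U h + error                                                ∎
      where
      open ≤-Reasoning
      base : ℕ → ℕ
      base b = (1 + b * P) * h
      lemma : ∀ C U B K → C * (U + B) + 7 * K ≡ C * U + (7 * K + C * B)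
      lemma = solve-∀
      unfold : ∀ b k P h → (1 + (b + k) * P) * h ≡ (1 + b * P) * h + k * (P * h)
      unfold = solve-∀
      along : ∀ b {w : ℕ → ℕ} → (∀ k → w k ≡ (1 + (b + k) * P) * h) → ∑ K (low ∘ w) ≡ ∑ (K′ * q) (λ k → low (base b + k * (P * h)))
      along b eq = trans (∑-cong K (λ k _ → cong low (trans (eq k) (unfold b k P h)))) (cong (λ m → ∑ m (λ k → low (base b + k * (P * h)))) K≡)
      swap : ∀ K q r → K * q * r ≡ q * (K * r)
      swap = solve-∀
      travel′ : C * d ≤ K′ * r
      travel′ = *-cancelˡ-≤ q (begin
        q * (C * d)       ≤⟨ *-monoˡ-≤ (C * d) q≤C ⟩
        C * (C * d)       ≤⟨ travel ⟩
        K * R             ≤⟨ *-monoʳ-≤ K R≤r ⟩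
        K * r             ≡⟨ trans (cong (_* r) K≡) (swap K′ q r) ⟩
        q * (K′ * r)      ∎)

    torsion-element : ∀ {h e} .{{_ : NonZero e}} → h ∈ H → e ∣ s → e ≤ C * P → e * h ≈± e → V h ≤ U h
    torsion-element {h} {e} h∈ e∣s e≤CP rel = ∑-mono K pointwise
      where
      pointwise : ∀ k → k < K → good k * low (v k * h) ≤ good k * low (u k * h)
      pointwise k k<K with quality k
      ... | neither eq _ rewrite eq = z≤n
      ... | both cu cv _ = *-monoʳ-≤ (good k) (subst (λ z → low (z * h) ≤ low (u k * h)) (sym (v≡u+s k))
              (low-shift e∣s cu (units h∈) 2<d (2u<d k k<K) (subst (λ z → d ≤ 2 * z) (v≡u+s k) (d≤2v k))
                (≤-<-trans (*-monoʳ-≤ 2 (*-monoˡ-≤ s e≤CP)) short) rel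
                (λ { refl → -1∉H h∈ }) (λ { (4∣d , refl) → 1+d/2∉H (4∣d , h∈) })))

    each-element : ∀ {h} → h ∈ H → C * V h ≤ C * U h + error
    each-element {h} h∈ with dirichlet C (P * h)
    ... | q , r , 1≤q , q≤C , Cr≤d , rel with R ≤? r
    ...   | yes R≤r = generic-element {{>-nonZero 1≤q}} {{>-nonZero (<-≤-trans (>-nonZero⁻¹ R) R≤r)}} q≤C (divides-K 1≤q q≤C) Cr≤d R≤r rel
    ...   | no  R≰r with order-bound sub h∈
    ...     | m , 1≤m , m≤n , ord = ≤-trans (*-monoʳ-≤ C (torsion-element {{e≢0}} h∈ (*-monoˡ-∣ P (divides-K 1≤q q≤C)) e≤CP
                                      (subst (q * P * h ≈±_) (sym e≡r) rel′))) (m≤m+n (C * U h) error)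
      where
      instance
        m≢0 : NonZero m
        m≢0 = >-nonZero 1≤m
      e = q * P
      e≢0 : NonZero e
      e≢0 = m*n≢0 q P {{>-nonZero 1≤q}}
      e≤CP : e ≤ C * P
      e≤CP = *-monoˡ-≤ P q≤C
      rel′ : e * h ≈± r
      rel′ = subst (_≈± r) (sym (*-assoc q P h)) rel
      small : ∀ {x} → x ≤ R → (x * x) ^ m < d
      small x≤R = ≤-<-trans (≤-trans (^-monoˡ-≤ m (*-mono-≤ x≤R x≤R)) (^-monoʳ-≤ (R * R) {{m*n≢0 R R}} m≤n)) R²ⁿ<d
      -- Both `e ≤ C * P ≤ R` and `r < R` are short enough for `short-relation`, so `e h ≡ ±r`
      -- becomes `e h ≡ ±e`.
      e≡r : e ≡ r
      e≡r = short-relation {m = m} ord rel′ (small (≤-trans e≤CP CP≤R)) (small (<⇒≤ (≰⇒> R≰r)))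

    -- Summed over `H`, the `U` and `V` parts cancel by balance, and the `n` errors have to cover
    -- the gap at the identity.
    total : C * K ≤ n * error
    total = +-cancelˡ-≤ (C * ∑ˡ U H) (C * K) (n * error) (begin
      C * ∑ˡ U H + C * K                          ≡⟨ cong (_+ C * K) (trans (cong (C *_) (sym ∑ˡU≡∑ˡV)) (sym (∑ˡ-* C V H))) ⟩
      ∑ˡ (λ h → C * V h) H + C * K                ≤⟨ ∑ˡ-mono-gap {f = λ h → C * V h} {λ h → C * U h} one∈
                                                       (≤-trans identity-gap (+-monoʳ-≤ (C * U (1 % d)) (m≤n+m (C * #bad) (7 * K)))) each-element ⟩
      ∑ˡ (λ h → C * U h) H + n * error            ≡⟨ cong (_+ n * error) (∑ˡ-* C U H) ⟩
      C * ∑ˡ U H + n * error                      ∎)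
      where open ≤-Reasoning

    module _ {y ps} .{{_ : NonZero y}} .{{_ : NonZero K}} .{{_ : NonZero n}} (large : LargePrimes d y ps)
             (small∣P : ∀ {p} → Prime p → p ≤ y → p ∣ P) (y∣K : y ∣ K) (few : 8 * n * length ps < y) where

      K″ = quotient y∣K
      ω = length ps

      #bad-≤ : #bad ≤ 2 * (ω * K″)
      #bad-≤ = begin
        #bad                                                                              ≡⟨ ∑-+ K (λ k → noncoprime-at (a + k)) (λ k → noncoprime-at (a + (K + k))) ⟩
        ∑ K (λ k → noncoprime-at (a + k)) + ∑ K (λ k → noncoprime-at (a + (K + k)))       ≤⟨ +-mono-≤ (count a) (≤-trans (≤-reflexive
                                                                                               (∑-cong K (λ k _ → cong noncoprime-at (sym (+-assoc a K k))))) (count (a + K))) ⟩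
        ω * K″ + ω * K″                                                                   ≡⟨ cong (ω * K″ +_) (+-identityʳ (ω * K″)) ⟨
        2 * (ω * K″)                                                                      ∎
        where
        open ≤-Reasoning
        noncoprime-at : ℕ → ℕ
        noncoprime-at = noncoprime d P
        count : ∀ b → ∑ K (λ k → noncoprime-at (b + k)) ≤ ω * K″
        count b = subst (λ m → ∑ m (λ k → noncoprime-at (b + k)) ≤ ω * K″) (sym (m∣n⇒n≡quotient*m y∣K)) (noncoprime-count large small∣P b K″)

      core-absurd : ⊥
      core-absurd = <⇒≱ few (*-cancelʳ-≤ y (8 * n * ω) K″ {{K″≢0}} (begin
        y * K″                          ≡⟨ trans (*-comm y K″) (sym (m∣n⇒n≡quotient*m y∣K)) ⟩
        K                               ≤⟨ m≤n*m K 3 ⟩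
        3 * K                           ≤⟨ 3K≤ ⟩
        4 * n * #bad                    ≤⟨ *-monoʳ-≤ (4 * n) #bad-≤ ⟩
        4 * n * (2 * (ω * K″))          ≡⟨ lemma₂ n ω K″ ⟩
        8 * n * ω * K″                  ∎))
        where
        open ≤-Reasoning
        K″≢0 : NonZero K″
        K″≢0 = quotient≢0 y∣K
        lemma₁ : ∀ n K B → 7 * n * (3 * K) + n * (7 * K + 28 * n * B) + 0 ≡ 7 * n * (4 * n * B) + 28 * n * K
        lemma₁ = solve-∀
        lemma₂ : ∀ n ω K → 4 * n * (2 * (ω * K)) ≡ 8 * n * ω * K
        lemma₂ = solve-∀
        -- `total` reads `28 n K ≤ 7 n K + 28 n² #bad`; divide by `7 n`.
        3K≤ : 3 * K ≤ 4 * n * #bad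
        3K≤ = *-cancelˡ-≤ (7 * n) {{m*n≢0 7 n}} (linear 0 (subst (λ c → c * K ≤ n * (7 * K + c * #bad)) C-large total) (lemma₁ n K #bad))

-- Bracketing d between consecutive values of an unbounded function

m<2^m : ∀ m → m < 2 ^ m
m<2^m zero    = s≤s z≤n
m<2^m (suc m) = subst (2 + m ≤_) (sym (2^suc m)) (+-mono-≤ (m^n>0 2 m) (m<2^m m))

module _ (g : ℕ → ℕ) {d : ℕ} where

  bracket-from : ∀ k J → g J ≤ d → d < g (J + k) → ∃[ J′ ] (J ≤ J′ × g J′ ≤ d × d < g (suc J′))
  bracket-from zero    J g≤d d<g = ⊥-elim (<⇒≱ d<g (subst (λ j → g j ≤ d) (sym (+-identityʳ J)) g≤d))
  bracket-from (suc k) J g≤d d<g with d <? g (suc J)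
  ... | yes d<g′ = J , ≤-refl , g≤d , d<g′
  ... | no  d≮g′ with bracket-from k (suc J) (≮⇒≥ d≮g′) (subst (λ j → d < g j) (+-suc J k) d<g)
  ...   | J′ , J<J′ , rest = J′ , <⇒≤ J<J′ , rest

  bracket : (∀ J → J < g J) → ∀ {J} → g J ≤ d → ∃[ J′ ] (J ≤ J′ × g J′ ≤ d × d < g (suc J′))
  bracket unbounded {J} g≤d = bracket-from d J g≤d (≤-<-trans (m≤n+m d J) (unbounded (J + d)))

-- Choice of the parameters

-- C is what the count Core.total needs, A makes the nth powers of squared short relations smaller
-- than d, and J₀ absorbs the constants into 4 ^ 2 ^ J and makes the primes above 2 ^ J few.
module Parameters (n : ℕ) where

  C A J₀ : ℕ
  C = 28 * n
  A = 6 * n + 1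
  J₀ = 32 * n * A + (4 * (C * C * C) + 2 * C * C !)

  scale : ℕ → ℕ
  scale J = (4 ^ 2 ^ J) ^ A

  4^≡2^ : ∀ k → 4 ^ k ≡ 2 ^ (2 * k)
  4^≡2^ k = ^-*-assoc 2 2 k

  scale≡2^ : ∀ J → scale J ≡ 2 ^ (2 * 2 ^ J * A)
  scale≡2^ J = trans (cong (_^ A) (4^≡2^ (2 ^ J))) (^-*-assoc 2 (2 * 2 ^ J) A)

  scale-unbounded : ∀ J → J < scale J
  scale-unbounded J = begin-strict
    J                        <⟨ m<2^m J ⟩
    2 ^ J                    <⟨ m<2^m (2 ^ J) ⟩
    2 ^ 2 ^ J                ≤⟨ ^-monoʳ-≤ 2 (≤-trans (m≤n*m (2 ^ J) 2) (m≤m*n (2 * 2 ^ J) A {{>-nonZero (m≤n+m 1 (6 * n))}})) ⟩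
    2 ^ (2 * 2 ^ J * A)      ≡⟨ scale≡2^ J ⟨
    scale J                  ∎
    where open ≤-Reasoning

module _ {d : ℕ} .{{_ : NonZero d}} {H : List ℕ} .{{n≢0 : NonZero (length H)}}
         (sub : IsSubgroup d H) (bal : Balanced d H) (2<d : 2 < d)
         (-1∉H : ¬ (d ∸ 1) ∈ H) (1+d/2∉H : ¬ ((4 ∣ d) × (d / 2 + 1) ∈ H)) where

  private n = length H
  open Parameters n

  module _ {J} (J₀≤J : J₀ ≤ J) (scale≤d : scale J ≤ d) (d<scale : d < scale (suc J)) where

    private
      y = 2 ^ J
      Z = 4 ^ y
      P = primorial-2^ J
      -- `K` is a multiple of `M`: `C !` supplies every `q ≤ C`, and `y` the block length for
      -- counting non-units.
      M = C ! * y
      B = 2 * (C * P * (M * P))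
      instance
        C≢0 : NonZero C
        C≢0 = m*n≢0 28 n
        P≢0 : NonZero P
        P≢0 = primorial-2^-nonZero J
        y≢0 : NonZero y
        y≢0 = m^n≢0 2 J
        M≢0 : NonZero M
        M≢0 = m*n≢0 (C !) y {{C !≢0}}
        B≢0 : NonZero B
        B≢0 = m*n≢0 2 _ {{_}} {{m*n≢0 (C * P) (M * P) {{m*n≢0 C P}} {{m*n≢0 M P}}}}
        Z≢0 : NonZero Z
        Z≢0 = m^n≢0 4 y
        R≢0 : NonZero (4 * (C * C * C) * (P * P))
        R≢0 = m*n≢0 (4 * (C * C * C)) (P * P) {{m*n≢0 4 (C * C * C) {{_}} {{m*n≢0 (C * C) C {{m*n≢0 C C}}}}}} {{m*n≢0 P P}}
      -- The largest `t` for which `short` holds with `K = M * t`; a large `K` permits a small `R`.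
      t = (d ∸ 1) / B
      K = M * t
      -- Solves `C * (C * (2 * (t * B))) = K * R`, which gives `travel` because `d ≤ 2 * (t * B)`.
      R = 4 * (C * C * C) * (P * P)

    J<Z : J < Z
    J<Z = <-trans (m<2^m J) (<-≤-trans (m<2^m y) (^-monoˡ-≤ y {2} {4} (s≤s (s≤s z≤n))))

    y≤Z : y ≤ Z
    y≤Z = ≤-trans (<⇒≤ (m<2^m y)) (^-monoˡ-≤ y {2} {4} (s≤s (s≤s z≤n)))

    1<Z : 1 < Z
    1<Z = <-≤-trans (s≤s (s≤s z≤n)) (^-monoʳ-≤ 4 {1} {y} (>-nonZero⁻¹ y))

    P≤Z : P ≤ Z
    P≤Z = primorial-2^-≤ J

    4C³≤Z : 4 * (C * C * C) ≤ Z
    4C³≤Z = ≤-trans (≤-trans (m≤m+n _ (2 * C * C !)) (m≤n+m _ (32 * n * A))) (≤-trans J₀≤J (<⇒≤ J<Z))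

    2CC!≤Z : 2 * C * C ! ≤ Z
    2CC!≤Z = ≤-trans (≤-trans (m≤n+m _ (4 * (C * C * C))) (m≤n+m _ (32 * n * A))) (≤-trans J₀≤J (<⇒≤ J<Z))

    Z^6n<d : Z ^ (6 * n) < d
    Z^6n<d = <-≤-trans (^-monoʳ-< Z 1<Z (m<m+n (6 * n) z<s)) scale≤d

    R≤Z³ : R ≤ Z * (Z * Z)
    R≤Z³ = *-mono-≤ 4C³≤Z (*-mono-≤ P≤Z P≤Z)

    -- By `R≤Z³`, the square and the `n`th power cost `6 * n` factors `Z`, one fewer than the `A`
    -- factors in `scale J`.
    R²ⁿ<d : (R * R) ^ n < d
    R²ⁿ<d = begin-strict
      (R * R) ^ n                               ≤⟨ ^-monoˡ-≤ n (*-mono-≤ R≤Z³ R≤Z³) ⟩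
      (Z * (Z * Z) * (Z * (Z * Z))) ^ n         ≡⟨ cong (_^ n) (lemma Z) ⟩
      (Z ^ 6) ^ n                               ≡⟨ ^-*-assoc Z 6 n ⟩
      Z ^ (6 * n)                               <⟨ Z^6n<d ⟩
      d                                         ∎
      where
      open ≤-Reasoning
      lemma : ∀ z → z * (z * z) * (z * (z * z)) ≡ z * (z * (z * (z * (z * (z * 1)))))
      lemma = solve-∀

    B<d : B < d
    B<d = begin-strict
      B                                         ≡⟨ lemma₁ C P (C !) y ⟩
      2 * C * C ! * (y * (P * P))               ≤⟨ *-mono-≤ 2CC!≤Z (*-mono-≤ y≤Z (*-mono-≤ P≤Z P≤Z)) ⟩
      Z * (Z * (Z * Z))                         ≡⟨ lemma₂ Z ⟩
      Z ^ 4                                     ≤⟨ ^-monoʳ-≤ Z (≤-trans (m≤n+m 4 2) (m≤m*n 6 n)) ⟩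
      Z ^ (6 * n)                               <⟨ Z^6n<d ⟩
      d                                         ∎
      where
      open ≤-Reasoning
      lemma₁ : ∀ C P F y → 2 * (C * P * (F * y * P)) ≡ 2 * C * F * (y * (P * P))
      lemma₁ = solve-∀
      lemma₂ : ∀ z → z * (z * (z * z)) ≡ z * (z * (z * (z * 1)))
      lemma₂ = solve-∀

    1+[d∸1] : 1 + (d ∸ 1) ≡ d
    1+[d∸1] = m+[n∸m]≡n (<⇒≤ (<⇒≤ 2<d))

    1≤t : 1 ≤ t
    1≤t = m≥n⇒m/n>0 (s≤s⁻¹ (subst (B <_) (sym 1+[d∸1]) B<d))

    short : 2 * (C * P * (K * P)) < d
    short = begin
      1 + 2 * (C * P * (M * t * P))     ≡⟨ cong suc (lemma C P M t) ⟩
      1 + t * B                         ≤⟨ s≤s (m/n*n≤m (d ∸ 1) B) ⟩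
      1 + (d ∸ 1)                       ≡⟨ 1+[d∸1] ⟩
      d                                 ∎
      where
      open ≤-Reasoning
      lemma : ∀ C P M t → 2 * (C * P * (M * t * P)) ≡ t * (2 * (C * P * (M * P)))
      lemma = solve-∀

    d≤2tB : d ≤ 2 * (t * B)
    d≤2tB = begin
      d                                 ≡⟨ 1+[d∸1] ⟨
      1 + (d ∸ 1)                       ≡⟨ cong suc (m≡m%n+[m/n]*n (d ∸ 1) B) ⟩
      1 + ((d ∸ 1) % B + t * B)         ≤⟨ linear 0 (+-mono-≤ (m%n<n (d ∸ 1) B) (*-monoˡ-≤ B 1≤t)) (lemma ((d ∸ 1) % B) B (t * B)) ⟩
      2 * (t * B)                       ∎
      where
      open ≤-Reasoning
      lemma : ∀ r B x → 1 + (r + x) + (B + x) + 0 ≡ 2 * x + (1 + r + 1 * B)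
      lemma = solve-∀

    travel : C * (C * d) ≤ K * R
    travel = ≤-trans (*-monoʳ-≤ C (*-monoʳ-≤ C d≤2tB)) (≤-reflexive (lemma C P M t))
      where
      lemma : ∀ C P M t → C * (C * (2 * (t * (2 * (C * P * (M * P)))))) ≡ M * t * (4 * (C * C * C) * (P * P))
      lemma = solve-∀

    CP≤R : C * P ≤ R
    CP≤R = ≤-trans (m≤m*n (C * P) (4 * (C * C) * P) {{m*n≢0 (4 * (C * C)) P {{m*n≢0 4 (C * C) {{_}} {{m*n≢0 C C}}}}}}) (≤-reflexive (lemma C P))
      where
      lemma : ∀ C P → C * P * (4 * (C * C) * P) ≡ 4 * (C * C * C) * (P * P)
      lemma = solve-∀

    -- From `2 ^ (J ω) = y ^ ω ≤ d < 2 ^ (4 A y)` follows `J ω < 4 A y`; then `J ≥ 32 n A` gives the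
    -- claim.
    few : ∀ {ps} → LargePrimes d y ps → 8 * n * length ps < y
    few {ps} (_ , y^ω≤d , _) = *-cancelˡ-< (4 * A) (8 * n * ω) y (begin-strict
      4 * A * (8 * n * ω)               ≡⟨ lemma₁ A n ω ⟩
      32 * n * A * ω                    ≤⟨ *-monoˡ-≤ ω (≤-trans (m≤m+n (32 * n * A) _) J₀≤J) ⟩
      J * ω                             <⟨ ≰⇒> (λ le → <⇒≱ 2^Jω<2^ (^-monoʳ-≤ 2 le)) ⟩
      2 * 2 ^ suc J * A                 ≡⟨ lemma₂ y A ⟩
      4 * A * y                         ∎)
      where
      open ≤-Reasoning
      ω = length ps
      lemma₁ : ∀ A n ω → 4 * A * (8 * n * ω) ≡ 32 * n * A * ω
      lemma₁ = solve-∀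
      lemma₂ : ∀ y A → 2 * (2 * y) * A ≡ 4 * A * y
      lemma₂ = solve-∀
      2^Jω<2^ : 2 ^ (J * ω) < 2 ^ (2 * 2 ^ suc J * A)
      2^Jω<2^ = begin-strict
        2 ^ (J * ω)                     ≡⟨ ^-*-assoc 2 J ω ⟨
        y ^ ω                           ≤⟨ y^ω≤d ⟩
        d                               <⟨ d<scale ⟩
        scale (suc J)                   ≡⟨ scale≡2^ (suc J) ⟩
        2 ^ (2 * 2 ^ suc J * A)         ∎

    not-balanced : ⊥
    not-balanced with large-primes d y
    ... | ps , large = Core.core-absurd sub bal 2<d -1∉H 1+d/2∉H {P} {C} {K} {R} refl
          (λ {q} 1≤q q≤C → ∣m⇒∣m*n t (∣m⇒∣m*n y (∣! {{>-nonZero 1≤q}} q≤C)))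
          short travel CP≤R R²ⁿ<d {{y≢0}} {{m*n≢0 M t {{M≢0}} {{>-nonZero 1≤t}}}} {{n≢0}} large (∣primorial-2^ J) (∣m⇒∣m*n t (n∣m*n (C !))) (few large)

bound : ℕ → ℕ
bound n = Parameters.scale n (Parameters.J₀ n)

theorem3p1 : ∀ (n : ℕ) → 1 ≤ n → ∃[ D ] (∀ (d : ℕ) .{{_ : NonZero d}} → 2 < d → D < d →
    ∀ (H : List ℕ) → IsSubgroup d H → length H ≡ n → Balanced d H →
    ((d ∸ 1) ∈ H) ⊎ ((4 ∣ d) × ((d / 2 + 1) ∈ H)))
theorem3p1 n 1≤n = bound n , main
  where
  main : ∀ (d : ℕ) .{{_ : NonZero d}} → 2 < d → bound n < d →
         ∀ (H : List ℕ) → IsSubgroup d H → length H ≡ n → Balanced d H →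
         ((d ∸ 1) ∈ H) ⊎ ((4 ∣ d) × ((d / 2 + 1) ∈ H))
  main d 2<d D<d H sub len bal with (d ∸ 1) ∈? H | (4 ∣? d) ×-dec ((d / 2 + 1) ∈? H)
  ... | yes p | _     = inj₁ p
  ... | no _  | yes p = inj₂ p
  ... | no ¬p | no ¬q with bracket (Parameters.scale (length H)) (Parameters.scale-unbounded (length H))
                                   (subst (λ m → bound m ≤ d) (sym len) (<⇒≤ D<d))
  ...   | J , J₀≤J , lower , upper =
          ⊥-elim (not-balanced {{n≢0 = >-nonZero (subst (1 ≤_) (sym len) 1≤n)}} sub bal 2<d ¬p ¬q J₀≤J lower upper)
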